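{- For single patterns in $S_3$ the following hold: (i) $[132]_{\mathrm{fp},\mathrm{exc},\mathrm{inv},\mathrm{crs},\mathrm{nes}}=\{132,213\}$; (ii) $[231]_{\mathrm{fp},\mathrm{inv},\mathrm{nes}}=\{231,312\}$; (iii) $[132]_{\mathrm{fp},\mathrm{exc},\mathrm{crs}}=\{132,213,321\}$.
   Context: $S_n(\tau)$: permutations of $[n]$ avoiding the pattern $\tau$. For $\sigma\in S_n$: $\mathrm{fp}(\sigma)=|\{i:\sigma(i)=i\}|$; $\mathrm{exc}(\sigma)=|\{i:\sigma(i)>i\}|$; $\mathrm{inv}(\sigma)=|\{(i,j):i<j,\ \sigma(i)>\sigma(j)\}|$; a crossing is a pair $(i,j)$ with $i<j<\sigma(i)<\sigma(j)$ or $\sigma(i)<\sigma(j)\le i<j$, a nesting a pair with $i<j<\sigma(j)<\sigma(i)$ or $\sigma(j)<\sigma(i)\le i<j$, and $\mathrm{crs},\mathrm{nes}$ count them. Patterns $\tau,\tau'$ are $(\mathrm{st}_1,\dots,\mathrm{st}_k)$-Wilf-equivalent if for every $n$, $\sum_{\sigma\in S_n(\tau)}\prod_i x_i^{\mathrm{st}_i(\sigma)}=\sum_{\sigma\in S_n(\tau')}\prod_i x_i^{\mathrm{st}_i(\sigma)}$. $[\tau]_{\mathrm{st}_1,\dots,\mathrm{st}_k}$ denotes the set of $\tau'\in S_3$ that are $(\mathrm{st}_1,\dots,\mathrm{st}_k)$-Wilf-equivalent to $\tau$. -}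

module Defs where

open import Data.Nat using (ℕ; zero; suc; _≡ᵇ_; _<ᵇ_; _≤ᵇ_)
open import Data.Bool using (Bool; true; false; _∧_; _∨_; not; if_then_else_)
open import Data.List using (List; []; _∷_; [_]; map; _++_; concatMap; length; upTo; zip)
open import Data.Bool.ListAction using (all; any)
open import Data.Product using (_×_; _,_)
open import Relation.Binary.PropositionalEquality using (_≡_)

-- Permutations of [n] = {1,…,n} are represented in one-line notation as
-- lists σ = σ(1) ∷ σ(2) ∷ … ∷ σ(n) ∷ [].

_==ᴮ_ : Bool → Bool → Bool
true  ==ᴮ b = b
false ==ᴮ b = not b

_==ᴸ_ : List ℕ → List ℕ → Bool
[] ==ᴸ [] = true
(x ∷ xs) ==ᴸ (y ∷ ys) = (x ≡ᵇ y) ∧ (xs ==ᴸ ys)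
_ ==ᴸ _ = false

countB : {A : Set} → (A → Bool) → List A → ℕ
countB p [] = 0
countB p (x ∷ xs) = if p x then suc (countB p xs) else countB p xs

range1 : ℕ → List ℕ
range1 n = map suc (upTo n)

words : ℕ → ℕ → List (List ℕ)
words n zero = [ [] ]
words n (suc k) = concatMap (λ w → map (_∷ w) (range1 n)) (words n k)

isPerm : ℕ → List ℕ → Bool
isPerm n σ = (length σ ≡ᵇ n) ∧ all (λ i → countB (λ x → x ≡ᵇ i) σ ≡ᵇ 1) (range1 n)

S : ℕ → List (List ℕ)
S n = Data.List.filterᵇ (isPerm n) (words n n)
  where import Data.List

subseqs : {A : Set} → ℕ → List A → List (List A)
subseqs zero _ = [ [] ]
subseqs (suc k) [] = []
subseqs (suc k) (x ∷ xs) = map (x ∷_) (subseqs k xs) ++ subseqs (suc k) xs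

pairs : {A : Set} → List A → List (A × A)
pairs [] = []
pairs (x ∷ xs) = map (x ,_) xs ++ pairs xs

-- u and w (of equal length, distinct entries) are order-isomorphic
orderIso : List ℕ → List ℕ → Bool
orderIso u w = all (λ { ((a , c) , (b , d)) → (a <ᵇ b) ==ᴮ (c <ᵇ d) }) (pairs (zip u w))

contains : List ℕ → List ℕ → Bool
contains τ σ = any (λ s → orderIso s τ) (subseqs (length τ) σ)

avoids : List ℕ → List ℕ → Bool
avoids τ σ = not (contains τ σ)

graph : List ℕ → List (ℕ × ℕ)
graph σ = zip (range1 (length σ)) σ

Stat : Set
Stat = List ℕ → ℕ

fp : Stat
fp σ = countB (λ { (i , s) → i ≡ᵇ s }) (graph σ)

exc : Stat
exc σ = countB (λ { (i , s) → i <ᵇ s }) (graph σ)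

inv : Stat
inv σ = countB (λ { ((i , a) , (j , b)) → b <ᵇ a }) (pairs (graph σ))

-- crossings: i<j<σ(i)<σ(j)  or  σ(i)<σ(j)≤i<j   (here a = σ(i), b = σ(j))
crs : Stat
crs σ = countB (λ { ((i , a) , (j , b)) → ((j <ᵇ a) ∧ (a <ᵇ b)) ∨ ((a <ᵇ b) ∧ (b ≤ᵇ i)) })
               (pairs (graph σ))

-- nestings: i<j<σ(j)<σ(i)  or  σ(j)<σ(i)≤i<j
nes : Stat
nes σ = countB (λ { ((i , a) , (j , b)) → ((j <ᵇ b) ∧ (b <ᵇ a)) ∨ ((b <ᵇ a) ∧ (a ≤ᵇ i)) })
               (pairs (graph σ))

stats : List Stat → List ℕ → List ℕ
stats sts σ = map (λ st → st σ) sts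

-- (st_1,…,st_k)-Wilf-equivalence: for every n, the generating polynomials
-- Σ_{σ ∈ S_n(τ)} Π x_i^{st_i σ} agree, i.e. every coefficient (indexed by
-- the exponent vector v) agrees.
WilfEq : List Stat → List ℕ → List ℕ → Set
WilfEq sts τ τ′ = (n : ℕ) (v : List ℕ) →
  countB (λ σ → avoids τ σ ∧ (stats sts σ ==ᴸ v)) (S n)
    ≡ countB (λ σ → avoids τ′ σ ∧ (stats sts σ ==ᴸ v)) (S n)

{-# OPTIONS --safe #-}

-- Symmetries of the permutation diagram: inverse followed by reverse-complement preserves all five statistics
-- and exchanges 132 with 213, and taking inverses exchanges 231 with 312.  Inverses preserve the number of
-- nestings because as many arcs pass above a fixed point as below it.
--
-- For 132 and 321 in (iii), both classes grow by inserting one point, at position p + 1 with value q + 1 and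
-- q ≤ p, where no point of the diagram has q < value < position ≤ p.  Writing f for the number of fixed points
-- m with q < m ≤ p, such an insertion turns these into excedances and creates p − q − f crossings.
-- A 321-avoider grows at its last position; a 132-avoider grows by its first weak deficiency.  In both
-- classes the possible distances s = p − q are 0, …, a and f = min (s, r), where the label (a, r) becomes
-- (a + 1, r + 1) for s = 0 and (s, 0) for s > 0.  Hence the two generating trees are isomorphic.
-- All other patterns are already separated at n = 3.

module Submission where

open import Defs
open import Data.Bool using (Bool; true; false; if_then_else_; T; T?; _∧_; _∨_)
open import Data.Bool.ListAction using (any)
open import Data.Bool.Properties using (T-≡; T-∧)
open import Data.List using (List; []; _∷_; [_]; _++_; map; concat; concatMap; length; upTo; zip)
open import Data.List.Membership.Propositional using (_∈_; find; lose)
open import Data.List.Membership.Propositional.Properties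
  using (∈-∃++; ∈-++⁺ˡ; ∈-++⁺ʳ; ∈-++⁻; ∈-map⁺; ∈-map⁻; ∈-concatMap⁺; ∈-concatMap⁻; ∈-filter⁺; ∈-filter⁻; ∈-upTo⁺; ∈-upTo⁻)
open import Data.List.Properties
  using (∷-injectiveˡ; ∷-injectiveʳ; length-map; length-upTo; map-++; map-concatMap; map-cong; map-id-local; map-∘; concatMap-map; upTo-∷ʳ)
open import Data.List.Relation.Binary.Permutation.Propositional
  using (_↭_; ↭-refl; ↭-reflexive; ↭-sym; ↭-trans; ↭-prep; ↭⇒↭ₛ; module PermutationReasoning)
open import Data.List.Relation.Unary.All as All using (All; []; _∷_)
open import Data.List.Relation.Unary.AllPairs as AllPairs using (AllPairs; []; _∷_)
open import Data.List.Relation.Unary.Any using (here; there)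
open import Data.List.Relation.Unary.Unique.Propositional using (Unique)
open import Data.Nat
open import Data.Nat.ListAction using (sum)
open import Data.Nat.ListAction.Properties using (sum-↭; sum-++)
open import Data.Nat.Properties
open import Data.Nat.Solver using (module +-*-Solver)
open import Data.Product using (_×_; _,_; proj₁; proj₂; ∃-syntax)
open import Data.Sum using (_⊎_; inj₁; inj₂)
open import Data.Empty using (⊥-elim)
open import Function using (_∘_; id; _on_; _⇔_; mk⇔; Equivalence)
open import Relation.Binary using (tri<; tri≈; tri>)
open import Relation.Binary.PropositionalEquality hiding ([_])
open import Relation.Nullary using (¬_; contradiction; yes; no)
import Data.List.Relation.Binary.Permutation.Propositional.Properties as Perm
import Data.List.Relation.Binary.Permutation.Setoid.Properties as Permₛ
import Data.List.Relation.Unary.All.Properties as All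
import Data.List.Relation.Unary.AllPairs.Properties as AllPairs
import Data.List.Relation.Unary.Any.Properties as Any
import Data.List.Relation.Unary.Unique.Propositional.Properties as Unique

-- The empty region does two things. It keeps a point (m + 1, m) with both coordinates in the window
-- (q, p] from being pushed onto the diagonal, and it forces every position in the window to hold an
-- excedance, a fixed point or a value at most q, which makes the count of new crossings exact. The
-- change of (fp, exc, crs) then depends on s and f alone, so a label has to know only which
-- distances occur and how f depends on them. The windows of consecutive gaps are nested and differ
-- by one number; the first r of these numbers are the fixed points, whence f = min (s, r). An
-- insertion with s = 0 adds a fixed point in front, one with s > 0 leaves no fixed point in the
-- windows that remain. The two classes realise the same labels by different geometry: the gaps of a
-- 321-avoider share their position, those of a 132-avoider form a staircase. Permutations are lists
-- of points up to reordering, on which insertions and symmetries act pointwise; most changes are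
-- stated as equations of sums because subtraction on ℕ truncates.

private variable
  A B : Set

-- Opaque, so that comparisons of successors do not reduce and remain visible to `rewrite`.
opaque
  𝟙 : Bool → ℕ
  𝟙 b = if b then 1 else 0

  𝟙-true : ∀ {b} → T b → 𝟙 b ≡ 1
  𝟙-true {true} _ = refl

  𝟙-false : ∀ {b} → ¬ T b → 𝟙 b ≡ 0
  𝟙-false {true} ¬t = ⊥-elim (¬t _)
  𝟙-false {false} _ = refl

  lt le eq : ℕ → ℕ → ℕ
  lt m n = 𝟙 (m <ᵇ n)
  le m n = 𝟙 (m ≤ᵇ n)
  eq m n = 𝟙 (m ≡ᵇ n)

  lt-yes : ∀ {m n} → m < n → lt m n ≡ 1
  lt-yes m<n = 𝟙-true (<⇒<ᵇ m<n)

  lt-no : ∀ {m n} → n ≤ m → lt m n ≡ 0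
  lt-no {m} n≤m = 𝟙-false λ t → ≤⇒≯ n≤m (<ᵇ⇒< m _ t)

  le-yes : ∀ {m n} → m ≤ n → le m n ≡ 1
  le-yes m≤n = 𝟙-true (≤⇒≤ᵇ m≤n)

  le-no : ∀ {m n} → n < m → le m n ≡ 0
  le-no {m} n<m = 𝟙-false λ t → <⇒≱ n<m (≤ᵇ⇒≤ m _ t)

  eq-yes : ∀ {m n} → m ≡ n → eq m n ≡ 1
  eq-yes {m} {n} m≡n = 𝟙-true (≡⇒≡ᵇ m n m≡n)

  eq-no : ∀ {m n} → m ≢ n → eq m n ≡ 0
  eq-no {m} {n} m≢n = 𝟙-false λ t → m≢n (≡ᵇ⇒≡ m n t)

lt-⇔ : ∀ {i j k l} → (i < j → k < l) → (k < l → i < j) → lt i j ≡ lt k l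
lt-⇔ {i} {j} {k} {l} f g with i <? j
... | yes i<j = trans (lt-yes i<j) (sym (lt-yes (f i<j)))
... | no i≮j = trans (lt-no (≮⇒≥ i≮j)) (sym (lt-no (≮⇒≥ (i≮j ∘ g))))

-- Finite sums

∑ : List A → (A → ℕ) → ℕ
∑ xs f = sum (map f xs)

∑-cong : ∀ (xs : List A) {f g} → (∀ {x} → x ∈ xs → f x ≡ g x) → ∑ xs f ≡ ∑ xs g
∑-cong [] h = refl
∑-cong (x ∷ xs) h = cong₂ _+_ (h (here refl)) (∑-cong xs (h ∘ there))

∑-mono : ∀ (xs : List A) {f g} → (∀ {x} → x ∈ xs → f x ≤ g x) → ∑ xs f ≤ ∑ xs g
∑-mono [] h = z≤n
∑-mono (x ∷ xs) h = +-mono-≤ (h (here refl)) (∑-mono xs (h ∘ there))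

∑-0 : ∀ (xs : List A) {f} → (∀ {x} → x ∈ xs → f x ≡ 0) → ∑ xs f ≡ 0
∑-0 [] h = refl
∑-0 (x ∷ xs) h = cong₂ _+_ (h (here refl)) (∑-0 xs (h ∘ there))

interchange : ∀ a b c d → (a + b) + (c + d) ≡ (a + c) + (b + d)
interchange = solve 4 (λ a b c d → (a :+ b) :+ (c :+ d) := (a :+ c) :+ (b :+ d)) refl
  where open +-*-Solver

∑-+ : ∀ (xs : List A) f g → ∑ xs (λ x → f x + g x) ≡ ∑ xs f + ∑ xs g
∑-+ [] f g = refl
∑-+ (x ∷ xs) f g rewrite ∑-+ xs f g = interchange (f x) (g x) (∑ xs f) (∑ xs g)

∑-*ˡ : ∀ (xs : List A) c f → ∑ xs (λ x → c * f x) ≡ c * ∑ xs f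
∑-*ˡ [] c f = sym (*-zeroʳ c)
∑-*ˡ (x ∷ xs) c f rewrite ∑-*ˡ xs c f = sym (*-distribˡ-+ c (f x) (∑ xs f))

∑-swap : ∀ (xs : List A) (ys : List B) (f : A → B → ℕ) →
         ∑ xs (λ x → ∑ ys (f x)) ≡ ∑ ys (λ y → ∑ xs (λ x → f x y))
∑-swap [] ys f = sym (∑-0 ys (λ _ → refl))
∑-swap (x ∷ xs) ys f rewrite ∑-swap xs ys f = sym (∑-+ ys (f x) _)

∑-map : ∀ (h : A → B) xs f → ∑ (map h xs) f ≡ ∑ xs (f ∘ h)
∑-map h xs f = cong sum (sym (map-∘ xs))

∑-↭ : ∀ {xs ys : List A} f → xs ↭ ys → ∑ xs f ≡ ∑ ys f
∑-↭ f p = sum-↭ (Perm.map⁺ f p)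

∑∑ : List A → (A → A → ℕ) → ℕ
∑∑ xs K = ∑ xs λ x → ∑ xs (K x)

∑∑-cong : ∀ (xs : List A) {K L} → (∀ {x y} → x ∈ xs → y ∈ xs → K x y ≡ L x y) → ∑∑ xs K ≡ ∑∑ xs L
∑∑-cong xs h = ∑-cong xs λ x∈ → ∑-cong xs (h x∈)

∑∑-+ : ∀ (xs : List A) K L → ∑∑ xs (λ x y → K x y + L x y) ≡ ∑∑ xs K + ∑∑ xs L
∑∑-+ xs K L = trans (∑-cong xs λ {x} _ → ∑-+ xs (K x) (L x)) (∑-+ xs _ _)

∑∑-map : ∀ (h : A → B) xs K → ∑∑ (map h xs) K ≡ ∑∑ xs (λ x y → K (h x) (h y))
∑∑-map h xs K = trans (∑-map h xs _) (∑-cong xs λ {x} _ → ∑-map h xs (K (h x)))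

∑∑-flip : ∀ (xs : List A) K → ∑∑ xs (λ x y → K y x) ≡ ∑∑ xs K
∑∑-flip xs K = ∑-swap xs xs (λ x y → K y x)

∑∑-↭ : ∀ {xs ys : List A} K → xs ↭ ys → ∑∑ xs K ≡ ∑∑ ys K
∑∑-↭ {xs = xs} K p = trans (∑-cong xs λ {x} _ → ∑-↭ (K x) p) (∑-↭ _ p)

∑∑-∷ : ∀ z (xs : List A) K →
       ∑∑ (z ∷ xs) K ≡ K z z + ∑ xs (K z) + (∑ xs (λ x → K x z) + ∑∑ xs K)
∑∑-∷ z xs K = cong (K z z + ∑ xs (K z) +_) (∑-+ xs (λ x → K x z) (λ x → ∑ xs (K x)))

∈-range1⁺ : ∀ {n i} → 1 ≤ i → i ≤ n → i ∈ range1 n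
∈-range1⁺ (s≤s _) i≤n = ∈-map⁺ suc (∈-upTo⁺ i≤n)

∈-range1⁻ : ∀ {n i} → i ∈ range1 n → 1 ≤ i × i ≤ n
∈-range1⁻ i∈ with ∈-map⁻ suc i∈
... | j , j∈ , refl = s≤s z≤n , ∈-upTo⁻ j∈

range1-unique : ∀ n → Unique (range1 n)
range1-unique n = Unique.map⁺ suc-injective (Unique.upTo⁺ n)

range1-∷ʳ : ∀ n → range1 (suc n) ≡ range1 n ++ [ suc n ]
range1-∷ʳ n = trans (cong (map suc) (sym (upTo-∷ʳ n))) (map-++ suc (upTo n) [ n ])

∑-range1-suc : ∀ n f → ∑ (range1 (suc n)) f ≡ ∑ (range1 n) f + f (suc n)
∑-range1-suc n f = begin
  ∑ (range1 (suc n)) f            ≡⟨ cong (λ l → ∑ l f) (range1-∷ʳ n) ⟩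
  sum (map f (range1 n ++ [ suc n ])) ≡⟨ cong sum (map-++ f (range1 n) [ suc n ]) ⟩
  sum (map f (range1 n) ++ [ f (suc n) ]) ≡⟨ sum-++ (map f (range1 n)) [ f (suc n) ] ⟩
  ∑ (range1 n) f + (f (suc n) + 0) ≡⟨ cong (∑ (range1 n) f +_) (+-identityʳ _) ⟩
  ∑ (range1 n) f + f (suc n)      ∎
  where open ≡-Reasoning

∑-range1-le : ∀ n {m} → m ≤ n → ∑ (range1 n) (λ i → le i m) ≡ m
∑-range1-le n {m} m≤n with m≤n⇒m<n∨m≡n m≤n
∑-range1-le (suc n) {m} _ | inj₁ m<1+n
  rewrite ∑-range1-suc n (λ i → le i m) | le-no m<1+n | ∑-range1-le n (≤-pred m<1+n) = +-identityʳ m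
∑-range1-le zero _ | inj₂ refl = refl
∑-range1-le (suc n) _ | inj₂ refl
  rewrite ∑-range1-suc n (λ i → le i (suc n)) | le-yes (≤-refl {suc n})
  = trans (cong (_+ 1) (trans (∑-cong (range1 n) λ i∈ → let i≤n = proj₂ (∈-range1⁻ i∈) in
      trans (le-yes (m≤n⇒m≤1+n i≤n)) (sym (le-yes i≤n))) (∑-range1-le n ≤-refl))) (+-comm n 1)

∑-range1-eq : ∀ n {m} → 1 ≤ m → m ≤ n → ∑ (range1 n) (λ i → eq i m) ≡ 1
∑-range1-eq zero (s≤s _) ()
∑-range1-eq (suc n) {m} 1≤m m≤1+n with m≤n⇒m<n∨m≡n m≤1+n
... | inj₁ m<1+n rewrite ∑-range1-suc n (λ i → eq i m) | eq-no (>⇒≢ m<1+n)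
    | ∑-range1-eq n 1≤m (≤-pred m<1+n) = refl
... | inj₂ refl rewrite ∑-range1-suc n (λ i → eq i (suc n)) | eq-yes {suc n} refl =
  cong (_+ 1) (∑-0 (range1 n) λ i∈ → eq-no (<⇒≢ (s≤s (proj₂ (∈-range1⁻ i∈)))))

-- Permutations as sets of points

Point = ℕ × ℕ

Unique-resp-↭ : ∀ {xs ys : List A} → xs ↭ ys → Unique xs → Unique ys
Unique-resp-↭ {A} p = Permₛ.Unique-resp-↭ (setoid A) (↭⇒↭ₛ p)

-- No order is imposed on the list, so that maps of points such as inversion stay within the notion.
record IsPerm (n : ℕ) (P : List Point) : Set where
  constructor mkPerm
  field
    positions : map proj₁ P ↭ range1 n
    values    : map proj₂ P ↭ range1 n

unique⇒injective : ∀ (f : A → B) {xs} → Unique (map f xs) →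
                   ∀ {x y} → x ∈ xs → y ∈ xs → f x ≡ f y → x ≡ y
unique⇒injective f u (here refl) (here refl) e = refl
unique⇒injective f (a ∷ u) (here refl) (there y∈) e = contradiction e (All.lookup a (∈-map⁺ f y∈))
unique⇒injective f (a ∷ u) (there x∈) (here refl) e = contradiction (sym e) (All.lookup a (∈-map⁺ f x∈))
unique⇒injective f (_ ∷ u) (there x∈) (there y∈) e = unique⇒injective f u x∈ y∈ e

IsPerm-resp-↭ : ∀ {n P Q} → P ↭ Q → IsPerm n P → IsPerm n Q
IsPerm-resp-↭ p (mkPerm a b) = mkPerm (↭-trans (Perm.map⁺ proj₁ (↭-sym p)) a)
    (↭-trans (Perm.map⁺ proj₂ (↭-sym p)) b)

module _ {n P} (perm : IsPerm n P) where
  open IsPerm perm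

  position-∈ : ∀ {i a} → (i , a) ∈ P → 1 ≤ i × i ≤ n
  position-∈ x∈ = ∈-range1⁻ (Perm.∈-resp-↭ positions (∈-map⁺ proj₁ x∈))

  value-∈ : ∀ {i a} → (i , a) ∈ P → 1 ≤ a × a ≤ n
  value-∈ x∈ = ∈-range1⁻ (Perm.∈-resp-↭ values (∈-map⁺ proj₂ x∈))

  at-position : ∀ {i} → 1 ≤ i → i ≤ n → ∃[ a ] (i , a) ∈ P
  at-position 1≤i i≤n with ∈-map⁻ proj₁ (Perm.∈-resp-↭ (↭-sym positions) (∈-range1⁺ 1≤i i≤n))
  ... | (i , a) , x∈ , refl = a , x∈

  at-value : ∀ {a} → 1 ≤ a → a ≤ n → ∃[ i ] (i , a) ∈ P
  at-value 1≤i i≤n with ∈-map⁻ proj₂ (Perm.∈-resp-↭ (↭-sym values) (∈-range1⁺ 1≤i i≤n))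
  ... | (i , a) , x∈ , refl = i , x∈

  position-injective : ∀ {x y} → x ∈ P → y ∈ P → proj₁ x ≡ proj₁ y → x ≡ y
  position-injective = unique⇒injective proj₁ (Unique-resp-↭ (↭-sym positions) (range1-unique n))

  value-injective : ∀ {x y} → x ∈ P → y ∈ P → proj₂ x ≡ proj₂ y → x ≡ y
  value-injective = unique⇒injective proj₂ (Unique-resp-↭ (↭-sym values) (range1-unique n))

  ∑-positions : ∀ f → ∑ P (f ∘ proj₁) ≡ ∑ (range1 n) f
  ∑-positions f = trans (sym (∑-map proj₁ P f)) (∑-↭ f positions)

  ∑-values : ∀ f → ∑ P (f ∘ proj₂) ≡ ∑ (range1 n) f
  ∑-values f = trans (sym (∑-map proj₂ P f)) (∑-↭ f values)

-- Insertion of a point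

opaque
  shift unshift : ℕ → ℕ → ℕ
  shift k m = if m ≤ᵇ k then m else suc m
  unshift k m = if m ≤ᵇ k then m else pred m

  shift-≤ : ∀ {k m} → m ≤ k → shift k m ≡ m
  shift-≤ {k} {m} m≤k with m ≤ᵇ k in e
  ... | true = refl
  ... | false = contradiction (≤⇒≤ᵇ m≤k) (subst T e)

  shift-> : ∀ {k m} → k < m → shift k m ≡ suc m
  shift-> {k} {m} k<m with m ≤ᵇ k in e
  ... | true = contradiction (≤ᵇ⇒≤ m k (subst T (sym e) _)) (<⇒≱ k<m)
  ... | false = refl

  unshift-≤ : ∀ {k m} → m ≤ k → unshift k m ≡ m
  unshift-≤ {k} {m} m≤k with m ≤ᵇ k in e
  ... | true = refl
  ... | false = contradiction (≤⇒≤ᵇ m≤k) (subst T e)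

  unshift-> : ∀ {k m} → k < m → unshift k m ≡ pred m
  unshift-> {k} {m} k<m with m ≤ᵇ k in e
  ... | true = contradiction (≤ᵇ⇒≤ m k (subst T (sym e) _)) (<⇒≱ k<m)
  ... | false = refl

-- Indexed by the result: abstracting `shift k m` together with its view replaces it throughout the
-- goal by `m` or `suc m`.
data Shift (k m : ℕ) : ℕ → Set where
  low  : m ≤ k → Shift k m m
  high : k < m → Shift k m (suc m)

shift-view : ∀ k m → Shift k m (shift k m)
shift-view k m with m ≤? k
... | yes m≤k = subst (Shift k m) (sym (shift-≤ m≤k)) (low m≤k)
... | no m≰k  = subst (Shift k m) (sym (shift-> (≰⇒> m≰k))) (high (≰⇒> m≰k))

unshift-shift : ∀ k m → unshift k (shift k m) ≡ m
unshift-shift k m with shift k m | shift-view k m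
... | _ | low m≤k  = unshift-≤ m≤k
... | _ | high k<m = unshift-> (m<n⇒m<1+n k<m)

shift-unshift : ∀ {k m} → m ≢ suc k → shift k (unshift k m) ≡ m
shift-unshift {k} {m} m≢1+k with m ≤? k
... | yes m≤k = trans (cong (shift k) (unshift-≤ m≤k)) (shift-≤ m≤k)
... | no m≰k with m | ≰⇒> m≰k
...   | suc j | s≤s k≤j = trans (cong (shift k) (unshift-> (s≤s k≤j)))
                                (shift-> (≤∧≢⇒< k≤j (m≢1+k ∘ cong suc ∘ sym)))

shift-mono-< : ∀ k {i j} → i < j → shift k i < shift k j
shift-mono-< k {i} {j} i<j with shift k i | shift-view k i | shift k j | shift-view k j
... | _ | low _  | _ | low _  = i<j
... | _ | low _  | _ | high _ = m<n⇒m<1+n i<j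
... | _ | high p | _ | low q  = contradiction (<-≤-trans i<j q) (<-asym p)
... | _ | high _ | _ | high _ = s≤s i<j

shift-cancel-< : ∀ k {i j} → shift k i < shift k j → i < j
shift-cancel-< k {i} {j} h with i <? j
... | yes i<j = i<j
... | no i≮j with m≤n⇒m<n∨m≡n (≮⇒≥ i≮j)
...   | inj₁ j<i  = contradiction (shift-mono-< k j<i) (<-asym h)
...   | inj₂ refl = contradiction h (<-irrefl refl)

lt-shift : ∀ k i j → lt (shift k i) (shift k j) ≡ lt i j
lt-shift k i j = lt-⇔ (shift-cancel-< k) (shift-mono-< k)

shiftPoint unshiftPoint : ℕ → ℕ → Point → Point
shiftPoint p q (i , a) = shift p i , shift q a
unshiftPoint p q (i , a) = unshift p i , unshift q a

ins : ℕ → ℕ → List Point → List Point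
ins p q P = (suc p , suc q) ∷ map (shiftPoint p q) P

-- The image of `shift k` omits exactly k + 1. For k = n nothing moves; otherwise the largest entry
-- splits off and is raised.
range1-shift : ∀ n {k} → k ≤ n → suc k ∷ map (shift k) (range1 n) ↭ range1 (suc n)
range1-shift n {k} k≤n with m≤n⇒m<n∨m≡n k≤n
... | inj₂ refl = begin
  suc n ∷ map (shift n) (range1 n)  ≡⟨ cong (suc n ∷_)
      (map-id-local (All.tabulate λ i∈ → shift-≤ (proj₂ (∈-range1⁻ i∈)))) ⟩
  suc n ∷ range1 n                  ↭⟨ Perm.∷↭∷ʳ (suc n) (range1 n) ⟩
  range1 n ++ [ suc n ]             ≡⟨ range1-∷ʳ n ⟨
  range1 (suc n)                    ∎
  where open PermutationReasoning
range1-shift (suc n) {k} k≤n | inj₁ k<1+n = begin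
  suc k ∷ map (shift k) (range1 (suc n))
      ≡⟨ cong (λ l → suc k ∷ map (shift k) l) (range1-∷ʳ n) ⟩
  suc k ∷ map (shift k) (range1 n ++ [ suc n ])
      ≡⟨ cong (suc k ∷_) (map-++ (shift k) (range1 n) [ suc n ]) ⟩
  (suc k ∷ map (shift k) (range1 n)) ++ [ shift k (suc n) ]
      ↭⟨ Perm.++⁺ʳ [ shift k (suc n) ] (range1-shift n (≤-pred k<1+n)) ⟩
  range1 (suc n) ++ [ shift k (suc n) ]
      ≡⟨ cong (λ m → range1 (suc n) ++ [ m ]) (shift-> k<1+n) ⟩
  range1 (suc n) ++ [ suc (suc n) ]                      ≡⟨ range1-∷ʳ (suc n) ⟨
  range1 (suc (suc n))                                   ∎
  where open PermutationReasoning

map-cancel-↭ : ∀ {f : A → B} {g} → (∀ x → g (f x) ≡ x) → ∀ {xs ys} → map f xs ↭ map f ys → xs ↭ ys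
map-cancel-↭ {f = f} {g} inv {xs} {ys} p =
  ↭-trans (↭-reflexive (cancel xs)) (↭-trans (Perm.map⁺ g p) (↭-reflexive (sym (cancel ys))))
  where
  cancel : ∀ zs → zs ≡ map g (map f zs)
  cancel zs = trans (sym (map-id-local (All.universal inv zs))) (map-∘ zs)

ins-positions : ∀ p q P → map proj₁ (ins p q P) ≡ suc p ∷ map (shift p) (map proj₁ P)
ins-positions p q P = cong (suc p ∷_) (trans (sym (map-∘ P)) (map-∘ P))

ins-values : ∀ p q P → map proj₂ (ins p q P) ≡ suc q ∷ map (shift q) (map proj₂ P)
ins-values p q P = cong (suc q ∷_) (trans (sym (map-∘ P)) (map-∘ P))

ins-isPerm : ∀ {n p q P} → p ≤ n → q ≤ n → IsPerm n P → IsPerm (suc n) (ins p q P)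
ins-isPerm {n} {p} {q} {P} p≤n q≤n (mkPerm ps vs) = mkPerm
  (↭-trans (↭-reflexive (ins-positions p q P)) (↭-trans (↭-prep _ (Perm.map⁺ _ ps)) (range1-shift n p≤n)))
  (↭-trans (↭-reflexive (ins-values p q P)) (↭-trans (↭-prep _ (Perm.map⁺ _ vs)) (range1-shift n q≤n)))

ins-isPerm⁻ : ∀ {n p q P} → p ≤ n → q ≤ n → IsPerm (suc n) (ins p q P) → IsPerm n P
ins-isPerm⁻ {n} {p} {q} {P} p≤n q≤n (mkPerm ps vs) = mkPerm
  (map-cancel-↭ {g = unshift p} (unshift-shift p)
      (Perm.drop-∷ (↭-trans (↭-reflexive (sym (ins-positions p q P)))
      (↭-trans ps (↭-sym (range1-shift n p≤n))))))
  (map-cancel-↭ {g = unshift q} (unshift-shift q)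
      (Perm.drop-∷ (↭-trans (↭-reflexive (sym (ins-values p q P)))
      (↭-trans vs (↭-sym (range1-shift n q≤n))))))

ins-cancel : ∀ {p q P P′} → ins p q P ↭ ins p q P′ → P ↭ P′
ins-cancel {p} {q} h = map-cancel-↭ {g = unshiftPoint p q}
  (λ { (i , a) → cong₂ _,_ (unshift-shift p i) (unshift-shift q a) }) (Perm.drop-∷ h)

ins-cong : ∀ {p q P P′} → P ↭ P′ → ins p q P ↭ ins p q P′
ins-cong h = ↭-prep _ (Perm.map⁺ _ h)

-- Pulling the point to the front and closing up the rest with `unshift` inverts the insertion,
-- because no other point shares its position or its value.
ins-remove : ∀ {n p q Q} → IsPerm (suc n) Q → (suc p , suc q) ∈ Q →
             ∃[ P ] Q ↭ ins p q P × IsPerm n P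
ins-remove {n} {p} {q} {Q} perm x∈ with ∈-∃++ x∈
... | ys , zs , refl = P , Q↭ , ins-isPerm⁻ (≤-pred (proj₂ (position-∈ perm x∈)))
    (≤-pred (proj₂ (value-∈ perm x∈)))
                                   (IsPerm-resp-↭ Q↭ perm)
  where
  P = map (unshiftPoint p q) (ys ++ zs)
  Q↭x∷ : Q ↭ (suc p , suc q) ∷ (ys ++ zs)
  Q↭x∷ = Perm.shift (suc p , suc q) ys zs
  perm′ = IsPerm-resp-↭ Q↭x∷ perm
  fresh-position : ∀ {i a} → (i , a) ∈ ys ++ zs → i ≢ suc p
  fresh-position y∈ refl with Unique-resp-↭ (↭-sym (IsPerm.positions perm′)) (range1-unique (suc n))
  ... | h ∷ _ = All.lookup h (∈-map⁺ proj₁ y∈) refl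
  fresh-value : ∀ {i a} → (i , a) ∈ ys ++ zs → a ≢ suc q
  fresh-value y∈ refl with Unique-resp-↭ (↭-sym (IsPerm.values perm′)) (range1-unique (suc n))
  ... | h ∷ _ = All.lookup h (∈-map⁺ proj₂ y∈) refl
  Q↭ : Q ↭ ins p q P
  Q↭ = ↭-trans Q↭x∷ (↭-prep _ (↭-reflexive (trans
    (sym (map-id-local (All.tabulate λ y∈ →
        cong₂ _,_ (shift-unshift (fresh-position y∈)) (shift-unshift (fresh-value y∈)))))
    (map-∘ (ys ++ zs)))))

-- Effect of an insertion on fp, exc and crs

fpK excK : Point → ℕ
fpK (i , a) = eq i a
excK (i , a) = lt i a

-- The two kinds of crossing exclude each other, so their disjunction becomes a sum.
crsK : Point → Point → ℕ
crsK (i , a) (j , b) = lt i j * (lt a b * (lt j a + le b i))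

fpₚ excₚ crsₚ : List Point → ℕ
fpₚ P = ∑ P fpK
excₚ P = ∑ P excK
crsₚ P = ∑∑ P crsK

-- For q ≤ p these are the numbers m for which value m is raised while position m stays.
within : ℕ → ℕ → ℕ → ℕ
within q p m = lt q m * le m p

fixedWithin : ℕ → ℕ → List Point → ℕ
fixedWithin q p P = ∑ P λ { (i , a) → within q p i * eq i a }

within-yes : ∀ {q p m} → q < m → m ≤ p → within q p m ≡ 1
within-yes h k rewrite lt-yes h | le-yes k = refl

within-≤ : ∀ {q p m} → m ≤ q → within q p m ≡ 0
within-≤ h rewrite lt-no h = refl

within-> : ∀ {q p m} → p < m → within q p m ≡ 0
within-> {q} {m = m} h rewrite le-no h = *-zeroʳ (lt q m)

eq-sym : ∀ m n → eq m n ≡ eq n m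
eq-sym m n with m ≟ n
... | yes refl = refl
... | no m≢n = trans (eq-no m≢n) (sym (eq-no (m≢n ∘ sym)))

le+lt : ∀ m n → le m n + lt n m ≡ 1
le+lt m n with m ≤? n
... | yes h rewrite le-yes h | lt-no h = refl
... | no h rewrite le-no (≰⇒> h) | lt-yes (≰⇒> h) = refl

le-suc : ∀ m n → le (suc m) (suc n) ≡ le m n
le-suc m n with m ≤? n
... | yes h = trans (le-yes (s≤s h)) (sym (le-yes h))
... | no h = trans (le-no (s≤s (≰⇒> h))) (sym (le-no (≰⇒> h)))

le-suc-lt : ∀ m n → le (suc m) n ≡ lt m n
le-suc-lt m n with m <? n
... | yes h = trans (le-yes h) (sym (lt-yes h))
... | no h = trans (le-no (s≤s (≮⇒≥ h))) (sym (lt-no (≮⇒≥ h)))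

-- Only a comparison of equal numbers inside the window changes, because there the value rises and
-- the position stays. The position and the value may belong to different points, which is the case
-- needed for crossings.
lt-shift₂ : ∀ {q p} → q ≤ p → ∀ i a → lt (shift p i) (shift q a) ≡ lt i a + within q p i * eq i a
lt-shift₂ {q} {p} q≤p i a with <-cmp i a
lt-shift₂ {q} {p} q≤p i a | tri< i<a i≢a _ rewrite lt-yes i<a | eq-no i≢a | *-zeroʳ (within q p i)
  with shift p i | shift-view p i | shift q a | shift-view q a
... | _ | low _  | _ | low _  = lt-yes i<a
... | _ | low _  | _ | high _ = lt-yes (m<n⇒m<1+n i<a)
... | _ | high h | _ | low k  = contradiction (<-≤-trans i<a k) (≤⇒≯ (≤-trans q≤p (<⇒≤ h)))
... | _ | high _ | _ | high _ = lt-yes (s≤s i<a)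
lt-shift₂ {q} {p} q≤p i .i | tri≈ _ refl _ rewrite lt-no (≤-refl {i}) | eq-yes {i} refl
    | *-identityʳ (within q p i)
  with shift p i | shift-view p i | shift q i | shift-view q i
... | _ | low _  | _ | low k  = trans (lt-no ≤-refl) (sym (within-≤ k))
... | _ | low h  | _ | high k = trans (lt-yes ≤-refl) (sym (within-yes k h))
... | _ | high h | _ | low k  = contradiction (<-≤-trans h k) (≤⇒≯ q≤p)
... | _ | high h | _ | high _ = trans (lt-no ≤-refl) (sym (within-> h))
lt-shift₂ {q} {p} q≤p i a | tri> _ i≢a a<i rewrite lt-no (<⇒≤ a<i) | eq-no i≢a | *-zeroʳ (within q p i)
  with shift p i | shift-view p i | shift q a | shift-view q a
... | _ | low _  | _ | low _  = lt-no (<⇒≤ a<i)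
... | _ | low _  | _ | high _ = lt-no a<i
... | _ | high _ | _ | low _  = lt-no (<⇒≤ (m<n⇒m<1+n a<i))
... | _ | high _ | _ | high _ = lt-no (s≤s (<⇒≤ a<i))

le-shift₂ : ∀ {q p} → q ≤ p → ∀ b i → le (shift q b) (shift p i) + within q p i * eq i b ≡ le b i
le-shift₂ {q} {p} q≤p b i = +-cancelʳ-≡ (lt i b) _ _ (begin
  le (shift q b) (shift p i) + within q p i * eq i b + lt i b
    ≡⟨ +-assoc (le (shift q b) (shift p i)) _ _ ⟩
  le (shift q b) (shift p i) + (within q p i * eq i b + lt i b)
    ≡⟨ cong (le (shift q b) (shift p i) +_) (trans (+-comm _ (lt i b)) (sym (lt-shift₂ q≤p i b))) ⟩
  le (shift q b) (shift p i) + lt (shift p i) (shift q b)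
    ≡⟨ le+lt (shift q b) (shift p i) ⟩
  1 ≡⟨ le+lt b i ⟨
  le b i + lt i b ∎)
  where open ≡-Reasoning

module Insertion {n P q p} (perm : IsPerm n P) (q≤p : q ≤ p) (p≤n : p ≤ n)
  (no-low : ∀ {i a} → (i , a) ∈ P → q < i → i ≤ p → q < a → a ≤ p → i ≤ a) where

  private
    I = within q p
    F = fixedWithin q p P
    s = shiftPoint p q

  -- The fixed points in the window leave the diagonal, and the new point lies on it exactly when p
  -- = q.
  fp-ins : fpₚ (ins p q P) + F ≡ fpₚ P + eq p q
  fp-ins = begin
    eq (suc p) (suc q) + ∑ (map s P) fpK + F ≡⟨ cong₂ (λ x y → x + y + F) eq-suc (∑-map s P fpK) ⟩
    eq p q + ∑ P (fpK ∘ s) + F     ≡⟨ trans (+-assoc (eq p q) _ _) (+-comm (eq p q) _) ⟩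
    ∑ P (fpK ∘ s) + F + eq p q     ≡⟨ cong (_+ eq p q)
        (trans (sym (∑-+ P _ _)) (∑-cong P λ {x} → point {x})) ⟩
    fpₚ P + eq p q                 ∎
    where
    open ≡-Reasoning
    eq-suc : eq (suc p) (suc q) ≡ eq p q
    eq-suc with p ≟ q
    ... | yes refl = trans (eq-yes {suc p} refl) (sym (eq-yes {p} refl))
    ... | no h = trans (eq-no (h ∘ suc-injective)) (sym (eq-no h))
    point : ∀ {x} → x ∈ P → fpK (s x) + I (proj₁ x) * eq (proj₁ x) (proj₂ x) ≡ fpK x
    point {i , a} x∈ with i ≟ a
    point {i , .i} x∈ | yes refl rewrite eq-yes {i} refl | *-identityʳ (I i)
      with shift p i | shift-view p i | shift q i | shift-view q i
    ... | _ | low _  | _ | low k rewrite within-≤ {p = p} k | eq-yes {i} refl = refl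
    ... | _ | low h  | _ | high k rewrite within-yes k h | eq-no {i} {suc i} (λ ()) = refl
    ... | _ | high h | _ | low k  = contradiction (<-≤-trans h k) (≤⇒≯ q≤p)
    ... | _ | high h | _ | high _ rewrite within-> {q} h | eq-yes {suc i} refl = refl
    point {i , a} x∈ | no i≢a rewrite eq-no i≢a | *-zeroʳ (I i) | +-identityʳ (eq (shift p i) (shift q a))
      with shift p i | shift-view p i | shift q a | shift-view q a
    ... | _ | low _  | _ | low k  = eq-no i≢a
    -- A point with i = a + 1 would land on the diagonal here; `no-low` excludes it.
    ... | _ | low h  | _ | high k = eq-no
        λ { refl → 1+n≰n (no-low x∈ (m<n⇒m<1+n k) h k (≤-trans (n≤1+n a) h)) }
    ... | _ | high h | _ | low k  = eq-no λ { refl → 1+n≰n (≤-trans (m<n⇒m<1+n h) (≤-trans k q≤p)) }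
    ... | _ | high h | _ | high _ = eq-no (i≢a ∘ suc-injective)

  exc-ins : excₚ (ins p q P) ≡ excₚ P + F
  exc-ins rewrite lt-no (s≤s q≤p) =
    trans (∑-map s P excK) (trans (∑-cong P λ { {i , a} _ → lt-shift₂ q≤p i a }) (∑-+ P _ _))

  private
    -- An insertion at (p , q) moves value m past position m exactly for q < m ≤ p.  A pair of old points
    -- thus becomes a crossing (de) at a double excedance m, and stops being one (dd) at a double descent m;
    -- V counts the m with σ⁻¹(m) > m < σ(m), which completes both to counts X and Y of single points.
    dd de V : Point → Point → ℕ
    de (i , a) (j , b) = lt i j * (lt a b * (I j * eq j a))
    dd (i , a) (j , b) = lt i j * (lt a b * (I i * eq i b))
    V  (i , a) (j , b) = I j * eq j a * (lt j i * lt j b)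

    -- `N₁` and `N₂` are the crossings of the new point with old points to its left and to its
    -- right.
    N₁ N₂ X Y : Point → ℕ
    N₁ (i , a) = le i p * (le a q * lt q i)
    N₂ (j , b) = lt p j * (lt q b * le b p)
    X  (j , b) = I j * lt j b
    Y  (i , a) = I a * lt a i

    z : Point
    z = suc p , suc q

    -- `lt-shift₂` enlarges the condition for upper crossings by `de`, and `le-shift₂` shrinks the
    -- one for lower crossings by `dd`.
    old-old : ∀ x y → crsK (s x) (s y) + dd x y ≡ crsK x y + de x y
    old-old (i , a) (j , b)
      rewrite lt-shift p i j | lt-shift q a b | lt-shift₂ q≤p j a | sym (le-shift₂ q≤p b i) =
      solve 6 (λ x y u v w t → x :* (y :* ((u :+ v) :+ w)) :+ x :* (y :* t)
                            := x :* (y :* (u :+ (w :+ t))) :+ x :* (y :* v))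
            refl (lt i j) (lt a b) (lt j a) (I j * eq j a) (le (shift q b) (shift p i)) (I i * eq i b)
      where open +-*-Solver

    new-old : ∀ y → crsK z (s y) ≡ N₂ y
    new-old (j , b) with shift p j | shift-view p j
    ... | _ | low h rewrite lt-no (m≤n⇒m≤1+n h) | lt-no h = refl
    ... | _ | high h rewrite lt-yes (s≤s h) | lt-yes h with shift q b | shift-view q b
    ...   | _ | low k rewrite lt-no (m≤n⇒m≤1+n k) | lt-no k = refl
    ...   | _ | high k rewrite lt-yes (s≤s k) | lt-yes k | lt-no (s≤s (≤-trans q≤p (<⇒≤ h)))
        | le-suc b p = refl

    old-new : ∀ x → crsK (s x) z ≡ N₁ x
    old-new (i , a) with shift p i | shift-view p i
    ... | _ | high h rewrite lt-no (s≤s (<⇒≤ h)) | le-no h = refl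
    ... | _ | low h rewrite lt-yes (s≤s h) | le-yes h with shift q a | shift-view q a
    ...   | _ | high k rewrite lt-no (s≤s (<⇒≤ k)) | le-no k = refl
    ...   | _ | low k rewrite lt-yes (s≤s k) | le-yes k | lt-no (m≤n⇒m≤1+n (≤-trans k q≤p))
        | le-suc-lt q i = refl

    -- For m in the window with m < σ(m), the preimage i of m differs from m: i < m makes m a double
    -- excedance, and i > m is counted by `V`.
    DE+V : ∑∑ P de + ∑∑ P V ≡ ∑ P X
    DE+V = sym (begin
      ∑ P X                                             ≡⟨ ∑-cong P (λ {x} → expand {x}) ⟩
      ∑ P (λ y → ∑ P (λ x → X y * eq (proj₂ x) (proj₁ y))) ≡⟨ ∑-swap P P _ ⟩
      ∑∑ P (λ x y → X y * eq (proj₂ x) (proj₁ y))       ≡⟨ ∑∑-cong P (λ {x} {y} → pair {x} {y}) ⟩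
      ∑∑ P (λ x y → de x y + V x y)                     ≡⟨ ∑∑-+ P de V ⟩
      ∑∑ P de + ∑∑ P V                                  ∎)
      where
      open ≡-Reasoning
      expand : ∀ {y} → y ∈ P → X y ≡ ∑ P (λ x → X y * eq (proj₂ x) (proj₁ y))
      expand {y@(j , b)} y∈ = sym (trans (∑-*ˡ P (X y) _) (trans
        (cong (X y *_) (trans (∑-values perm (λ a → eq a j))
            (∑-range1-eq n (proj₁ (position-∈ perm y∈)) (proj₂ (position-∈ perm y∈)))))
        (*-identityʳ (X y))))
      pair : ∀ {x y} → x ∈ P → y ∈ P → X y * eq (proj₂ x) (proj₁ y) ≡ de x y + V x y
      pair {i , a} {j , b} x∈ y∈ with a ≟ j
      ... | no h rewrite eq-no h | eq-no (h ∘ sym) | *-zeroʳ (I j * lt j b) | *-zeroʳ (I j)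
                       | *-zeroʳ (lt a b) | *-zeroʳ (lt i j) = refl
      ... | yes refl rewrite eq-yes {j} refl with <-cmp i j
      ...   | tri< h _ _ rewrite lt-yes h | lt-no (<⇒≤ h) | *-zeroʳ (I j * 1) =
        solve 2 (λ x y → x :* y :* con 1 := con 1 :* (y :* (x :* con 1)) :+ con 0) refl (I j) (lt j b)
        where open +-*-Solver
      ...   | tri> _ _ h rewrite lt-yes h | lt-no (<⇒≤ h) =
        solve 2 (λ x y → x :* y :* con 1 := con 0 :+ x :* con 1 :* (con 1 :* y)) refl (I j) (lt j b)
        where open +-*-Solver
      ...   | tri≈ _ refl _ with position-injective perm x∈ y∈ refl
      ...     | refl rewrite lt-no (≤-refl {j}) | *-zeroʳ (I j) | *-zeroʳ (I j * 1) = refl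

    -- Dually, for m in the window with σ⁻¹(m) > m, the image of m lies below m (a double descent)
    -- or above it (counted by `V`).
    DD+V : ∑∑ P dd + ∑∑ P V ≡ ∑ P Y
    DD+V = sym (begin
      ∑ P Y                                             ≡⟨ ∑-cong P (λ {x} → expand {x}) ⟩
      ∑∑ P (λ x y → Y x * eq (proj₁ y) (proj₂ x))       ≡⟨ ∑∑-cong P (λ {x} {y} → pair {x} {y}) ⟩
      ∑∑ P (λ x y → dd y x + V x y)                     ≡⟨ ∑∑-+ P (λ x y → dd y x) V ⟩
      ∑∑ P (λ x y → dd y x) + ∑∑ P V                    ≡⟨ cong (_+ ∑∑ P V) (∑∑-flip P dd) ⟩
      ∑∑ P dd + ∑∑ P V                                  ∎)
      where
      open ≡-Reasoning
      expand : ∀ {x} → x ∈ P → Y x ≡ ∑ P (λ y → Y x * eq (proj₁ y) (proj₂ x))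
      expand {x@(i , a)} x∈ = sym (trans (∑-*ˡ P (Y x) _) (trans
        (cong (Y x *_) (trans (∑-positions perm (λ j → eq j a))
            (∑-range1-eq n (proj₁ (value-∈ perm x∈)) (proj₂ (value-∈ perm x∈)))))
        (*-identityʳ (Y x))))
      pair : ∀ {x y} → x ∈ P → y ∈ P → Y x * eq (proj₁ y) (proj₂ x) ≡ dd y x + V x y
      pair {i , a} {j , b} x∈ y∈ with j ≟ a
      ... | no h rewrite eq-no h | *-zeroʳ (I a * lt a i) | *-zeroʳ (I j)
                       | *-zeroʳ (lt b a) | *-zeroʳ (lt j i) = refl
      ... | yes refl rewrite eq-yes {j} refl with <-cmp b j
      ...   | tri< h _ _ rewrite lt-yes h | lt-no (<⇒≤ h) =
        solve 2 (λ x y → x :* y :* con 1 := y :* (con 1 :* (x :* con 1)) :+ x :* con 1 :* (y :* con 0)) refl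
            (I j) (lt j i)
        where open +-*-Solver
      ...   | tri> _ _ h rewrite lt-yes h | lt-no (<⇒≤ h) =
        solve 2 (λ x y → x :* y :* con 1 := y :* con 0 :+ x :* con 1 :* (y :* con 1)) refl (I j) (lt j i)
        where open +-*-Solver
      ...   | tri≈ _ refl _ with value-injective perm x∈ y∈ refl
      ...     | refl rewrite lt-no (≤-refl {j}) | *-zeroʳ (I j) | *-zeroʳ (I j * 1) = refl

    -- By `no-low`, a position in the window holds an excedance (`X`), a fixed point or a value at
    -- most q (`N₁`), while a value in the window that lies below its position sits to the right of
    -- p, where `N₂` and `Y` agree. Hence the identity holds point by point.
    balance : ∀ {x} → x ∈ P → X x + N₁ x + N₂ x + I (proj₁ x) * fpK x ≡ Y x + I (proj₁ x)
    balance {i , a} x∈ with <-cmp i a | i ≤? p | i ≤? q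
    ... | _ | no i≰p | yes i≤q = contradiction (≤-trans i≤q q≤p) i≰p
    ... | tri< i<a i≢a _ | yes i≤p | yes i≤q
      rewrite within-≤ {p = p} i≤q | lt-no (≤-trans i≤q q≤p) | le-yes i≤p | lt-no i≤q | lt-no (<⇒≤ i<a)
            | *-zeroʳ (le a q) | *-zeroʳ (I a) = refl
    ... | tri≈ _ refl _ | yes i≤p | yes i≤q
      rewrite within-≤ {p = p} i≤q | lt-no (≤-trans i≤q q≤p) | lt-no i≤q | *-zeroʳ (le i q)
          | *-zeroʳ (le i p) = refl
    ... | tri> _ i≢a a<i | yes i≤p | yes i≤q
      rewrite within-≤ {p = p} i≤q | within-≤ {p = p} (≤-trans (<⇒≤ a<i) i≤q) | lt-no (≤-trans i≤q q≤p)
          | lt-no i≤q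
            | *-zeroʳ (le a q) | *-zeroʳ (le i p) = refl
    ... | tri< i<a i≢a _ | yes i≤p | no i≰q
      rewrite within-yes (≰⇒> i≰q) i≤p | lt-yes i<a | lt-no (<⇒≤ i<a) | eq-no i≢a | lt-no i≤p
            | le-no (<-trans (≰⇒> i≰q) i<a) | *-zeroʳ (le i p) | *-zeroʳ (I a) = refl
    ... | tri≈ _ refl _ | yes i≤p | no i≰q
      rewrite within-yes (≰⇒> i≰q) i≤p | lt-no (≤-refl {i}) | eq-yes {i} refl | lt-no i≤p
            | le-no (≰⇒> i≰q) | *-zeroʳ (le i p) = refl
    ... | tri> _ i≢a a<i | yes i≤p | no i≰q with a ≤? q
    ...   | yes a≤q rewrite within-yes (≰⇒> i≰q) i≤p | lt-no (<⇒≤ a<i) | eq-no i≢a | lt-no i≤p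
            | le-yes i≤p | le-yes a≤q | lt-yes (≰⇒> i≰q) | within-≤ {p = p} a≤q = refl
    ...   | no a≰q = contradiction (no-low x∈ (≰⇒> i≰q) i≤p (≰⇒> a≰q) (≤-trans (<⇒≤ a<i) i≤p)) (<⇒≱ a<i)
    balance {i , a} x∈ | tri< i<a i≢a _ | no i≰p | no i≰q
      rewrite within-> {q} (≰⇒> i≰p) | le-no (≰⇒> i≰p) | lt-no (<⇒≤ i<a) | le-no (<-trans (≰⇒> i≰p) i<a)
            | *-zeroʳ (lt q a) | *-zeroʳ (lt p i) = refl
    balance {i , a} x∈ | tri≈ _ refl _ | no i≰p | no i≰q
      rewrite within-> {q} (≰⇒> i≰p) | le-no (≰⇒> i≰p) | *-zeroʳ (lt p i) = refl
    balance {i , a} x∈ | tri> _ i≢a a<i | no i≰p | no i≰q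
      rewrite within-> {q} (≰⇒> i≰p) | le-no (≰⇒> i≰p) | lt-yes (≰⇒> i≰p) | lt-yes a<i =
      solve 2 (λ x y → con 1 :* (x :* y) :+ con 0 := x :* y :* con 1 :+ con 0) refl (lt q a) (le a p)
      where open +-*-Solver

    width : ∑ P (I ∘ proj₁) + q ≡ p
    width = begin
      ∑ P (I ∘ proj₁) + q
        ≡⟨ cong₂ _+_ (∑-positions perm I) (sym (∑-range1-le n (≤-trans q≤p p≤n))) ⟩
      ∑ (range1 n) I + ∑ (range1 n) (λ i → le i q)
        ≡⟨ ∑-+ (range1 n) I _ ⟨
      ∑ (range1 n) (λ i → I i + le i q)
        ≡⟨ ∑-cong (range1 n) (λ {i} _ → point i) ⟩
      ∑ (range1 n) (λ i → le i p)
        ≡⟨ ∑-range1-le n p≤n ⟩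
      p ∎
      where
      open ≡-Reasoning
      point : ∀ i → I i + le i q ≡ le i p
      point i with i ≤? q
      ... | yes h rewrite lt-no h | le-yes h | le-yes (≤-trans h q≤p) = refl
      ... | no h rewrite lt-yes (≰⇒> h) | le-no (≰⇒> h) | *-identityˡ (le i p) = +-identityʳ _

  -- Adding `V` on both sides turns double excedances and double descents into sums over single
  -- points; `balance` and `width` then leave p - q - F.
  crs-ins : crsₚ (ins p q P) + F + q ≡ crsₚ P + p
  crs-ins = +-cancelʳ-≡ (∑ P Y) _ _ (begin
    crsₚ (ins p q P) + F + q + ∑ P Y
      ≡⟨ cong₂ (λ x y → x + F + q + y) split (sym DD+V) ⟩
    n₂ + (n₁ + S′) + F + q + (∑∑ P dd + v)
      ≡⟨ solve 7 (λ n₂ n₁ S F q D v → n₂ :+ (n₁ :+ S) :+ F :+ q :+ (D :+ v) := (S :+ D) :+ v :+ n₁ :+ n₂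
          :+ F :+ q)
               refl n₂ n₁ S′ F q (∑∑ P dd) v ⟩
    (S′ + ∑∑ P dd) + v + n₁ + n₂ + F + q
      ≡⟨ cong (λ x → x + v + n₁ + n₂ + F + q) (trans (sym (∑∑-+ P _ dd))
           (trans (∑∑-cong P λ {x} {y} _ _ → old-old x y) (∑∑-+ P crsK de))) ⟩
    (crsₚ P + ∑∑ P de) + v + n₁ + n₂ + F + q
      ≡⟨ solve 7 (λ C D v n₁ n₂ F q → (C :+ D) :+ v :+ n₁ :+ n₂ :+ F :+ q := C
          :+ ((D :+ v) :+ n₁ :+ n₂ :+ F) :+ q)
               refl (crsₚ P) (∑∑ P de) v n₁ n₂ F q ⟩
    crsₚ P + ((∑∑ P de + v) + n₁ + n₂ + F) + q
      ≡⟨ cong (λ x → crsₚ P + x + q) total ⟩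
    crsₚ P + (∑ P Y + w) + q
      ≡⟨ solve 4 (λ C Y w q → C :+ (Y :+ w) :+ q := C :+ (w :+ q) :+ Y) refl (crsₚ P) (∑ P Y) w q ⟩
    crsₚ P + (w + q) + ∑ P Y
      ≡⟨ cong (λ x → crsₚ P + x + ∑ P Y) width ⟩
    crsₚ P + p + ∑ P Y ∎)
    where
    open ≡-Reasoning
    open +-*-Solver
    n₁ = ∑ P N₁
    n₂ = ∑ P N₂
    v = ∑∑ P V
    w = ∑ P (I ∘ proj₁)
    S′ = ∑∑ P (λ x y → crsK (s x) (s y))
    split : crsₚ (ins p q P) ≡ n₂ + (n₁ + S′)
    split = trans (∑∑-∷ z (map s P) crsK) (cong₂ _+_
      (cong₂ _+_ (cong (_* (lt (suc q) (suc q) * (lt (suc p) (suc q) + le (suc q) (suc p))))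
          (lt-no (≤-refl {suc p}))) (trans (∑-map s P (crsK z)) (∑-cong P λ {y} _ → new-old y)))
      (cong₂ _+_ (trans (∑-map s P (λ x → crsK x z)) (∑-cong P λ {x} _ → old-new x)) (∑∑-map s P crsK)))
    total : (∑∑ P de + v) + n₁ + n₂ + F ≡ ∑ P Y + w
    total = begin
      (∑∑ P de + v) + n₁ + n₂ + F ≡⟨ cong (λ x → x + n₁ + n₂ + F) DE+V ⟩
      ∑ P X + n₁ + n₂ + F
        ≡⟨ cong (λ x → x + n₂ + F) (∑-+ P X N₁) ⟨
      ∑ P (λ x → X x + N₁ x) + n₂ + F
        ≡⟨ cong (_+ F) (∑-+ P _ N₂) ⟨
      ∑ P (λ x → X x + N₁ x + N₂ x) + F
        ≡⟨ ∑-+ P _ _ ⟨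
      ∑ P (λ x → X x + N₁ x + N₂ x + I (proj₁ x) * fpK x)
        ≡⟨ ∑-cong P balance ⟩
      ∑ P (λ x → Y x + I (proj₁ x))
        ≡⟨ ∑-+ P Y _ ⟩
      ∑ P Y + w ∎

-- Generating trees

-- The statistics of a permutation together with what its insertions depend on: the valid gaps are at
-- distances 0, …, gaps from the diagonal, and s ⊓ run fixed points lie between the gap at distance s
-- and the diagonal; an insertion there turns them into excedances.
record Label : Set where
  constructor mkLabel
  field
    gaps run fixed excedances crossings : ℕ
open Label

grow : Label → ℕ → Label
grow (mkLabel a r f e c) zero = mkLabel (suc a) (suc r) (suc f) e c
grow (mkLabel a r f e c) s@(suc _) = mkLabel s 0 (f ∸ s ⊓ r) (e + s ⊓ r) (c + (s ∸ s ⊓ r))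

-- No permutation occurs here: both classes are compared by projecting their generated states onto
-- this one list.
Tree : ℕ → List Label
Tree zero = [ mkLabel 0 0 0 0 0 ]
Tree (suc n) = concatMap (λ l → map (grow l) (upTo (suc (gaps l)))) (Tree n)

-- Both coordinates are shifted at the same k, so old fixed points stay fixed; the window widened by
-- one keeps them and catches the new one.
ins-fixed : ∀ {q p k} → q ≤ k → k ≤ p → ∀ P →
            fixedWithin q (suc p) (ins k k P) ≡ suc (fixedWithin q p P)
ins-fixed {q} {p} {k} q≤k k≤p P = cong₂ _+_
  (trans (cong₂ _*_ (within-yes (s≤s q≤k) (s≤s k≤p)) (eq-yes {suc k} refl)) refl)
  (trans (∑-map (shiftPoint k k) P _) (∑-cong P λ {x} _ → point x))
  where
  point : ∀ x → within q (suc p) (shift k (proj₁ x)) * eq (shift k (proj₁ x)) (shift k (proj₂ x))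
              ≡ within q p (proj₁ x) * eq (proj₁ x) (proj₂ x)
  point (i , a) with i ≟ a
  ... | no i≢a rewrite eq-no i≢a
                     | eq-no {shift k i} {shift k a}
                         (λ e → i≢a (trans (sym (unshift-shift k i))
                         (trans (cong (unshift k) e) (unshift-shift k a))))
                     | *-zeroʳ (within q (suc p) (shift k i)) = sym (*-zeroʳ (within q p i))
  ... | yes refl rewrite eq-yes {i} refl | eq-yes {shift k i} refl with shift k i | shift-view k i
  ...   | _ | low h rewrite le-yes (≤-trans h k≤p) | le-yes (m≤n⇒m≤1+n (≤-trans h k≤p)) = refl
  ...   | _ | high h rewrite le-suc i p | lt-yes (≤-<-trans q≤k h)
      | lt-yes (m<n⇒m<1+n (≤-<-trans q≤k h)) = refl

fixedWithin-0 : ∀ {q p} P → (∀ {i a} → (i , a) ∈ P → q < i → i ≤ p → i ≢ a) → fixedWithin q p P ≡ 0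
fixedWithin-0 {q} {p} P h = ∑-0 P (λ {x} → point {x})
  where
  point : ∀ {x} → x ∈ P → within q p (proj₁ x) * eq (proj₁ x) (proj₂ x) ≡ 0
  point {i , a} x∈ with i ≤? q | i ≤? p
  ... | yes i≤q | _ rewrite within-≤ {p = p} i≤q = refl
  ... | no _ | no i≰p rewrite within-> {q} (≰⇒> i≰p) = refl
  ... | no i≰q | yes i≤p rewrite eq-no (h x∈ (≰⇒> i≰q) i≤p) = *-zeroʳ (within q p i)

-- The valid gaps are (p t , p t ∸ t) for t ≤ a; consecutive ones are one step apart.
record Gaps (Valid : ℕ → List Point → ℕ → ℕ → Set) (n : ℕ) (P : List Point) (a : ℕ) (p : ℕ → ℕ) : Set where
  field
    valid    : ∀ {t} → t ≤ a → ∃[ q ] q + t ≡ p t × Valid n P (p t) q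
    complete : ∀ {p′ q′} → Valid n P p′ q′ → ∃[ t ] t ≤ a × p′ ≡ p t × q′ + t ≡ p′
    advance  : ∀ {t} → t < a → p t ≤ p (suc t) × p (suc t) ≤ suc (p t)

-- `remove` and `ins-unique` provide a unique parent for every nonempty permutation of the class;
-- the second group of fields says which gaps survive an insertion, and hence determines the label.
record Class : Set₁ where
  field
    Avoid : List Point → Set
    Valid : ℕ → List Point → ℕ → ℕ → Set

    avoid-[]     : Avoid []
    valid-resp-↭ : ∀ {n P Q p q} → P ↭ Q → Valid n P p q → Valid n Q p q
    valid-≤      : ∀ {n P p q} → Valid n P p q → q ≤ p × p ≤ n
    no-low       : ∀ {n P p q} → IsPerm n P → Valid n P p q →
                   ∀ {i a} → (i , a) ∈ P → q < i → i ≤ p → q < a → a ≤ p → i ≤ a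
    avoid-ins    : ∀ {n P p q} → IsPerm n P → Avoid P → Valid n P p q → Avoid (ins p q P)
    remove       : ∀ {n Q} → IsPerm (suc n) Q → Avoid Q →
                   ∃[ p ] ∃[ q ] ∃[ P ] Q ↭ ins p q P × IsPerm n P × Avoid P × Valid n P p q
    ins-unique   : ∀ {n P p q P′ p′ q′} → IsPerm n P → Valid n P p q → Valid n P′ p′ q′ →
                   ins p q P ↭ ins p′ q′ P′ → p ≡ p′ × q ≡ q′

  field
    -- `next p s` gives the positions of the gaps of the child inserted at distance s, again indexed
    -- by distance.
    next     : (ℕ → ℕ) → ℕ → ℕ → ℕ
    next-suc : ∀ p t → next p 0 (suc t) ≡ suc (p t)
    gaps-[]  : Gaps Valid 0 [] 0 (λ _ → 0)
    gaps-0   : ∀ {n P a p} → IsPerm n P → Gaps Valid n P a p →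
               Gaps Valid (suc n) (ins (p 0) (p 0) P) (suc a) (next p 0)
    gaps-suc : ∀ {n P a p q s} → IsPerm n P → Gaps Valid n P a p → suc s ≤ a → q + suc s ≡ p (suc s) →
               Gaps Valid (suc n) (ins (p (suc s)) q P) (suc s) (next p (suc s))
    -- This resets `run` to 0 after an insertion off the diagonal.
    no-fixed : ∀ {n P a p q s} → IsPerm n P → Gaps Valid n P a p → suc s ≤ a → q + suc s ≡ p (suc s) →
               ∀ {t q′} → t ≤ suc s → q′ + t ≡ next p (suc s) t →
               ∀ {i b} → (i , b) ∈ ins (p (suc s)) q P → q′ < i → i ≤ next p (suc s) t → i ≢ b

module Gaps-mono {a : ℕ} (p : ℕ → ℕ) (advance : ∀ {t} → t < a → p t ≤ p (suc t) × p (suc t) ≤ suc (p t)) where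

  -- Each unit of distance moves p up or q down by one. The second inequality is the monotonicity of
  -- q = p - t, written without subtraction.
  mono : ∀ {t u} → t ≤′ u → u ≤ a → p t ≤ p u × p u + t ≤ p t + u
  mono ≤′-refl _ = ≤-refl , ≤-refl
  mono {t} {suc u} (≤′-step h) u<a with mono h (<⇒≤ u<a) | advance u<a
  ... | x , y | z , w = ≤-trans x z , (begin
    p (suc u) + t ≤⟨ +-monoˡ-≤ t w ⟩
    suc (p u) + t ≤⟨ s≤s y ⟩
    suc (p t + u) ≡⟨ +-suc (p t) u ⟨
    p t + suc u   ∎)
    where open ≤-Reasoning

  p-mono : ∀ {t u} → t ≤ u → u ≤ a → p t ≤ p u
  p-mono h k = proj₁ (mono (≤⇒≤′ h) k)

  q-anti : ∀ {t u q r} → t ≤ u → u ≤ a → q + t ≡ p t → r + u ≡ p u → r ≤ q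
  q-anti {t} {u} {q} {r} h k e f = +-cancelʳ-≤ (t + u) r q (begin
    r + (t + u) ≡⟨ trans (cong (r +_) (+-comm t u)) (sym (+-assoc r u t)) ⟩
    r + u + t   ≡⟨ cong (_+ t) f ⟩
    p u + t     ≤⟨ proj₂ (mono (≤⇒≤′ h) k) ⟩
    p t + u     ≡⟨ cong (_+ u) e ⟨
    q + t + u   ≡⟨ +-assoc q t u ⟩
    q + (t + u) ∎)
    where open ≤-Reasoning

module Generate (C : Class) where
  open Class C

  record State : Set where
    constructor mkState
    field
      lab    : Label
      points : List Point
      gapPos : ℕ → ℕ
  open State public

  child : State → ℕ → State
  child (mkState l P p) s = mkState (grow l s) (ins (p s) (p s ∸ s) P) (next p s)

  children : State → List State
  children st = map (child st) (upTo (suc (gaps (lab st))))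

  Gen : ℕ → List State
  Gen zero = [ mkState (mkLabel 0 0 0 0 0) [] (λ _ → 0) ]
  Gen (suc n) = concatMap children (Gen n)

  labels : ∀ n → map lab (Gen n) ≡ Tree n
  labels zero = refl
  labels (suc n) = begin
    map lab (concatMap children (Gen n)) ≡⟨ map-concatMap lab children (Gen n) ⟩
    concatMap (map lab ∘ children) (Gen n)
        ≡⟨ cong concat (map-cong (λ st → sym (map-∘ (upTo (suc (gaps (lab st)))))) (Gen n)) ⟩
    concatMap (λ st → map (grow (lab st)) (upTo (suc (gaps (lab st))))) (Gen n)
      ≡⟨ concatMap-map (λ l → map (grow l) (upTo (suc (gaps l)))) lab (Gen n) ⟨
    concatMap (λ l → map (grow l) (upTo (suc (gaps l)))) (map lab (Gen n))
      ≡⟨ cong (concatMap _) (labels n) ⟩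
    Tree (suc n) ∎
    where open ≡-Reasoning

  record Inv (n : ℕ) (st : State) : Set where
    field
      perm  : IsPerm n (points st)
      avoid : Avoid (points st)
      gaps′ : Gaps Valid n (points st) (gaps (lab st)) (gapPos st)
      fixes : ∀ {t q} → t ≤ gaps (lab st) → q + t ≡ gapPos st t →
              fixedWithin q (gapPos st t) (points st) ≡ t ⊓ run (lab st)
      fp-≡  : fpₚ (points st) ≡ fixed (lab st)
      exc-≡ : excₚ (points st) ≡ excedances (lab st)
      crs-≡ : crsₚ (points st) ≡ crossings (lab st)

  child-q : ∀ {n st s} → Inv n st → s ≤ gaps (lab st) →
            gapPos st s ∸ s + s ≡ gapPos st s × Valid n (points st) (gapPos st s) (gapPos st s ∸ s)
  child-q {n} {st} {s} I s≤a with Gaps.valid (Inv.gaps′ I) s≤a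
  ... | q , q+s≡p , v rewrite sym q+s≡p | m+n∸n≡m q s = refl , v

  child-inv : ∀ {n st s} → Inv n st → s ≤ gaps (lab st) → Inv (suc n) (child st s)
  child-inv {n} {st@(mkState (mkLabel a r f e c) P p)} {zero} I _ = record
    { perm  = ins-isPerm k≤n k≤n perm
    ; avoid = avoid-ins perm avoid v
    ; gaps′ = gaps-0 perm gaps′
    ; fixes = fixes-0
    ; fp-≡  = trans (trans (sym (+-identityʳ _))
        (trans (cong (fpₚ (ins (p 0) (p 0) P) +_) (sym F≡0)) fp-ins))
                (trans (cong₂ _+_ fp-≡ (eq-yes {p 0} refl)) (+-comm f 1))
    ; exc-≡ = trans (exc-ins) (trans (cong₂ _+_ exc-≡ F≡0) (+-identityʳ e))
    ; crs-≡ = trans (+-cancelʳ-≡ (p 0) _ _ (trans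
        (cong (_+ p 0) (trans (sym (+-identityʳ _)) (cong (crsₚ (ins (p 0) (p 0) P) +_) (sym F≡0))))
                (crs-ins))) crs-≡
    }
    where
    open Inv I
    v = proj₂ (child-q I z≤n)
    k≤n = proj₂ (valid-≤ v)
    open Insertion perm ≤-refl k≤n (no-low perm v)
    F≡0 : fixedWithin (p 0) (p 0) P ≡ 0
    F≡0 = fixes {0} z≤n (+-identityʳ (p 0))
    fixes-0 : ∀ {t q} → t ≤ suc a → q + t ≡ next p 0 t →
              fixedWithin q (next p 0 t) (ins (p 0) (p 0) P) ≡ t ⊓ suc r
    fixes-0 {zero} {q} _ q≡ = fixedWithin-0 {q} (ins (p 0) (p 0) P)
      λ _ q<i i≤ → contradiction (<-≤-trans q<i i≤) (≤⇒≯ (≤-reflexive (trans (sym q≡) (+-identityʳ q))))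
    fixes-0 {suc t} {q} (s≤s t≤a) q≡ rewrite next-suc p t = trans
      (ins-fixed (q-anti z≤n t≤a (+-identityʳ (p 0)) q+t) (p-mono z≤n t≤a) P) (cong suc (fixes t≤a q+t))
      where
      open Gaps-mono p (Gaps.advance gaps′)
      q+t : q + t ≡ p t
      q+t = suc-injective (trans (sym (+-suc q t)) q≡)
  child-inv {n} {st@(mkState (mkLabel a r f e c) P p)} {s@(suc s₀)} I s≤a = record
    { perm  = ins-isPerm p≤n (≤-trans q≤p p≤n) perm
    ; avoid = avoid-ins perm avoid v
    ; gaps′ = gaps-suc perm gaps′ s≤a q+s
    ; fixes = λ {t} {q′} t≤s q′+t → trans
        (fixedWithin-0 {q′} (ins (p s) q P) (no-fixed perm gaps′ s≤a q+s t≤s q′+t)) (sym (⊓-zeroʳ t))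
    ; fp-≡  = begin
        fpₚ (ins (p s) q P)               ≡⟨ m+n∸n≡m _ m ⟨
        fpₚ (ins (p s) q P) + m ∸ m       ≡⟨ cong (λ x → fpₚ (ins (p s) q P) + x ∸ m) F≡m ⟨
        fpₚ (ins (p s) q P) + F ∸ m       ≡⟨ cong (_∸ m) fp-ins ⟩
        fpₚ P + eq (p s) q ∸ m            ≡⟨ cong (_∸ m) (cong₂ _+_ fp-≡ (eq-no (p≢q ∘ trans q+s))) ⟩
        f + 0 ∸ m                         ≡⟨ cong (_∸ m) (+-identityʳ f) ⟩
        f ∸ m                             ∎
    ; exc-≡ = trans (exc-ins) (cong₂ _+_ exc-≡ F≡m)
    ; crs-≡ = +-cancelʳ-≡ m _ _ (+-cancelʳ-≡ q _ _ (begin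
        crsₚ (ins (p s) q P) + m + q      ≡⟨ cong (λ x → crsₚ (ins (p s) q P) + x + q) F≡m ⟨
        crsₚ (ins (p s) q P) + F + q      ≡⟨ crs-ins ⟩
        crsₚ P + p s                      ≡⟨ cong₂ _+_ crs-≡ (trans (sym q+s) (+-comm q s)) ⟩
        c + (s + q)                       ≡⟨ +-assoc c s q ⟨
        c + s + q                         ≡⟨ cong (λ x → c + x + q) (m∸n+n≡m (m⊓n≤m s r)) ⟨
        c + (s ∸ m + m) + q               ≡⟨ cong (_+ q) (+-assoc c (s ∸ m) m) ⟨
        c + (s ∸ m) + m + q               ∎))
    }
    where
    open Inv I
    open ≡-Reasoning
    q = p s ∸ s
    m = s ⊓ r
    q+s = proj₁ (child-q I s≤a)
    v = proj₂ (child-q I s≤a)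
    q≤p = proj₁ (valid-≤ v)
    p≤n = proj₂ (valid-≤ v)
    open Insertion perm q≤p p≤n (no-low perm v)
    F = fixedWithin q (p s) P
    F≡m : F ≡ m
    F≡m = fixes s≤a q+s
    p≢q : q + s ≢ q
    p≢q e = m+1+n≢m q e

  ∈-children⁻ : ∀ {st st′} → st′ ∈ children st → ∃[ s ] s ≤ gaps (lab st) × st′ ≡ child st s
  ∈-children⁻ {st} h with ∈-map⁻ (child st) h
  ... | s , s∈ , refl = s , ≤-pred (∈-upTo⁻ s∈) , refl

  gen-inv : ∀ n {st} → st ∈ Gen n → Inv n st
  gen-inv zero (here refl) = record
    { perm = mkPerm ↭-refl ↭-refl ; avoid = avoid-[] ; gaps′ = gaps-[]
    ; fixes = λ { z≤n e → refl } ; fp-≡ = refl ; exc-≡ = refl ; crs-≡ = refl }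
  gen-inv (suc n) h with find (∈-concatMap⁻ children {xs = Gen n} h)
  ... | st , st∈ , c∈ with ∈-children⁻ c∈
  ...   | s , s≤a , refl = child-inv (gen-inv n st∈) s≤a

  -- Up to `↭`, because point lists in different orders describe the same permutation.
  Distinct : State → State → Set
  Distinct st st′ = ¬ (points st ↭ points st′)

  child-unique : ∀ {n st st′ s s′} → Inv n st → Inv n st′ → s ≤ gaps (lab st) → s′ ≤ gaps (lab st′) →
                 points (child st s) ↭ points (child st′ s′) → s ≡ s′ × points st ↭ points st′
  child-unique {st = st} {st′} {s} {s′} I I′ s≤ s′≤ h with child-q I s≤ | child-q I′ s′≤
  ... | q+s , v | q′+s′ , v′ with ins-unique (Inv.perm I) v v′ h
  ...   | e , f = +-cancelˡ-≡ (gapPos st s ∸ s) s s′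
      (trans q+s (trans e (trans (sym q′+s′) (cong (_+ s′) (sym f)))))
                , ins-cancel (subst₂ (λ x y → points (child st s) ↭ ins x y (points st′)) (sym e) (sym f) h)

  gen-distinct : ∀ n → AllPairs Distinct (Gen n)
  gen-distinct zero = All.[] ∷ []
  gen-distinct (suc n) = go (Gen n) (gen-inv n) (gen-distinct n)
    where
    go : ∀ sts → (∀ {st} → st ∈ sts → Inv n st) → AllPairs Distinct sts →
         AllPairs Distinct (concatMap children sts)
    go [] _ _ = []
    go (st ∷ sts) inv (d ∷ ds) = AllPairs.++⁺
      (AllPairs.map⁺ (AllPairs.applyUpTo⁺₁ id _ λ i<j j≤a h →
        <⇒≢ i<j (proj₁ (child-unique I I (≤-trans (<⇒≤ i<j) (≤-pred j≤a)) (≤-pred j≤a) h))))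
      (go sts (inv ∘ there) ds)
      (All.tabulate λ c∈ → All.tabulate λ c′∈ → apart c∈ c′∈)
      where
      I = inv (here refl)
      apart : ∀ {c c′} → c ∈ children st → c′ ∈ concatMap children sts → Distinct c c′
      apart c∈ c′∈ h with ∈-children⁻ c∈ | find (∈-concatMap⁻ children {xs = sts} c′∈)
      ... | s , s≤ , refl | st′ , st′∈ , c′∈′ with ∈-children⁻ c′∈′
      ...   | s′ , s′≤ , refl = All.lookup d st′∈ (proj₂ (child-unique I (inv (there st′∈)) s≤ s′≤ h))

  -- Validity is transported along `↭` from the parent found by `remove` to its generated copy,
  -- where `complete` supplies the distance.
  gen-complete : ∀ n {Q} → IsPerm n Q → Avoid Q → ∃[ st ] st ∈ Gen n × points st ↭ Q
  gen-complete zero {[]} perm _ = _ , here refl , ↭-refl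
  gen-complete zero {x ∷ Q} perm _ with Perm.↭-empty-inv (IsPerm.positions perm)
  ... | ()
  gen-complete (suc n) {Q} perm avoid with remove perm avoid
  ... | p , q , P , Q↭ , permP , avoidP , v with gen-complete n permP avoidP
  ...   | st , st∈ , st↭P with Gaps.complete (Inv.gaps′ (gen-inv n st∈)) (valid-resp-↭ (↭-sym st↭P) v)
  ...     | t , t≤a , refl , q+t = child st t
          , ∈-concatMap⁺ children (lose st∈ (∈-map⁺ (child st) (∈-upTo⁺ (s≤s t≤a))))
          , ↭-trans (subst (λ x → ins (gapPos st t) (gapPos st t ∸ t) (points st) ↭ ins (gapPos st t) x P)
                       (trans (cong (_∸ t) (sym q+t)) (m+n∸n≡m q t)) (ins-cong st↭P)) (↭-sym Q↭)

-- Patterns in point sets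

-- For numerals t and u this computes to a single strict inequality.
Cmp : ℕ → ℕ → ℕ → ℕ → Set
Cmp t u a b = if t <ᵇ u then a < b else b < a

record HasPattern (t u v : ℕ) (P : List Point) : Set where
  constructor occurs
  field
    {i a j b k c} : ℕ
    x∈ : (i , a) ∈ P
    y∈ : (j , b) ∈ P
    z∈ : (k , c) ∈ P
    i<j : i < j
    j<k : j < k
    ab  : Cmp t u a b
    ac  : Cmp t v a c
    bc  : Cmp u v b c

pattern-resp-↭ : ∀ {t u v P Q} → P ↭ Q → HasPattern t u v P → HasPattern t u v Q
pattern-resp-↭ h (occurs x∈ y∈ z∈ i<j j<k ab ac bc) =
  occurs (Perm.∈-resp-↭ h x∈) (Perm.∈-resp-↭ h y∈) (Perm.∈-resp-↭ h z∈) i<j j<k ab ac bc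

Cmp-map : ∀ (f : ℕ → ℕ) → (∀ {a b} → a < b → f a < f b) → ∀ t u {a b} → Cmp t u a b → Cmp t u (f a) (f b)
Cmp-map f mono t u h with t <ᵇ u
... | true  = mono h
... | false = mono h

∈-ins⁺ : ∀ {p q P i a} → (i , a) ∈ P → (shift p i , shift q a) ∈ ins p q P
∈-ins⁺ {p} {q} x∈ = there (∈-map⁺ (shiftPoint p q) x∈)

data Ins (p q : ℕ) (P : List Point) : Point → Set where
  new : Ins p q P (suc p , suc q)
  old : ∀ {i a} → (i , a) ∈ P → Ins p q P (shift p i , shift q a)

∈-ins⁻ : ∀ {p q P x} → x ∈ ins p q P → Ins p q P x
∈-ins⁻ (here refl) = new
∈-ins⁻ {p} {q} (there x∈) with ∈-map⁻ (shiftPoint p q) x∈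
... | _ , y∈ , refl = old y∈

pattern-ins : ∀ {t u v p q P} → HasPattern t u v P → HasPattern t u v (ins p q P)
pattern-ins {t} {u} {v} {p} {q} (occurs x∈ y∈ z∈ i<j j<k ab ac bc) =
  occurs (∈-ins⁺ x∈) (∈-ins⁺ y∈) (∈-ins⁺ z∈) (shift-mono-< p i<j) (shift-mono-< p j<k)
    (Cmp-map _ (shift-mono-< q) t u ab) (Cmp-map _ (shift-mono-< q) t v ac)
        (Cmp-map _ (shift-mono-< q) u v bc)

shift<1+k : ∀ {k m} → shift k m < suc k → m ≤ k
shift<1+k {k} {m} h with shift k m | shift-view k m
... | _ | low m≤k = m≤k
... | _ | high k<m = contradiction (≤-pred h) (<⇒≱ (m<n⇒m<1+n k<m))

1+k<shift : ∀ {k m} → suc k < shift k m → k < m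
1+k<shift {k} {m} h with shift k m | shift-view k m
... | _ | low m≤k = contradiction (≤-trans (n≤1+n _) h) (≤⇒≯ m≤k)
... | _ | high k<m = k<m

k<shift : ∀ {k m} → k < shift k m → k < m
k<shift {k} {m} h with shift k m | shift-view k m
... | _ | low _ = h
... | _ | high k<m = k<m

m≤shift : ∀ k m → m ≤ shift k m
m≤shift k m with shift k m | shift-view k m
... | _ | low _ = ≤-refl
... | _ | high _ = n≤1+n m

shift≤1+m : ∀ k m → shift k m ≤ suc m
shift≤1+m k m with shift k m | shift-view k m
... | _ | low _ = n≤1+n m
... | _ | high _ = ≤-refl

shift-mono-≤ : ∀ k {i j} → i ≤ j → shift k i ≤ shift k j
shift-mono-≤ k h with m≤n⇒m<n∨m≡n h
... | inj₁ i<j = <⇒≤ (shift-mono-< k i<j)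
... | inj₂ refl = ≤-refl

shift-cancel-≤ : ∀ k {i j} → shift k i ≤ shift k j → i ≤ j
shift-cancel-≤ k {i} {j} h = ≮⇒≥ (λ j<i → <⇒≱ (shift-mono-< k j<i) h)

value-≢⇒< : ∀ {n P} → IsPerm n P → ∀ {i a j b} → (i , a) ∈ P → (j , b) ∈ P → i < j → ¬ b < a → a < b
value-≢⇒< perm x∈ y∈ i<j b≮a = ≤∧≢⇒< (≮⇒≥ b≮a) λ a≡b → <⇒≢ i<j (cong proj₁ (value-injective perm x∈ y∈ a≡b))

-- A permutation avoiding 321 is built by appending a last entry.

record Valid₃₂₁ (n : ℕ) (P : List Point) (p q : ℕ) : Set where
  constructor mkValid
  field
    p≡n : p ≡ n
    q≤n : q ≤ n
    right : ∀ {i a j b} → (i , a) ∈ P → (j , b) ∈ P → q < a → q < b → i < j → a < b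

module Class₃₂₁ where

  Avoid : List Point → Set
  Avoid P = ¬ HasPattern 3 2 1 P

  -- All gaps sit behind the last entry, so every position is an old one plus one; only the heights
  -- distinguish the gaps.
  next : (ℕ → ℕ) → ℕ → ℕ → ℕ
  next p zero zero = suc (p 0)
  next p zero (suc t) = suc (p t)
  next p (suc s) t = suc (p t)

  -- Entries above q increase, so nothing to the left of (i , a) exceeds a: the i positions up to i
  -- carry values among the a values up to a. The comparison of sums expresses this.
  no-low : ∀ {n P p q} → IsPerm n P → Valid₃₂₁ n P p q →
           ∀ {i a} → (i , a) ∈ P → q < i → i ≤ p → q < a → a ≤ p → i ≤ a
  no-low {n} {P} perm (mkValid refl q≤n right) {i} {a} x∈ q<i i≤n q<a a≤n = begin
    i                                 ≡⟨ ∑-range1-le n i≤n ⟨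
    ∑ (range1 n) (λ j → le j i)       ≡⟨ ∑-positions perm _ ⟨
    ∑ P (λ y → le (proj₁ y) i)        ≤⟨ ∑-mono P (λ {y} → point {y}) ⟩
    ∑ P (λ y → le (proj₂ y) a)        ≡⟨ ∑-values perm _ ⟩
    ∑ (range1 n) (λ b → le b a)       ≡⟨ ∑-range1-le n a≤n ⟩
    a                                 ∎
    where
    open ≤-Reasoning
    point : ∀ {y} → y ∈ P → le (proj₁ y) i ≤ le (proj₂ y) a
    point {j , b} y∈ with j ≤? i | b ≤? a
    ... | no h | _ rewrite le-no (≰⇒> h) = z≤n
    ... | yes h | yes k rewrite le-yes h | le-yes k = ≤-refl
    ... | yes h | no k with m≤n⇒m<n∨m≡n h
    ...   | inj₁ j<i = contradiction (right y∈ x∈ (<-trans q<a (≰⇒> k)) q<a j<i) (<-asym (≰⇒> k))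
    ...   | inj₂ refl with position-injective perm x∈ y∈ refl
    ...     | refl = contradiction ≤-refl k

  -- The new entry is the last one and can only play the 1 of a 321, which `right` forbids.
  avoid-ins : ∀ {n P p q} → IsPerm n P → Avoid P → Valid₃₂₁ n P p q → Avoid (ins p q P)
  avoid-ins {n} {p = p} {q} perm avoid (mkValid refl q≤n right) (occurs x∈ y∈ z∈ i<j j<k b<a c<a c<b)
    with ∈-ins⁻ x∈ | ∈-ins⁻ y∈ | ∈-ins⁻ z∈
  ... | old x | old y | old z = avoid (occurs x y z (shift-cancel-< p i<j) (shift-cancel-< p j<k)
                                    (shift-cancel-< q b<a) (shift-cancel-< q c<a) (shift-cancel-< q c<b))
  ... | old x | old y | new = <-asym (shift-cancel-< q b<a)
      (right x y (1+k<shift c<a) (1+k<shift c<b) (shift-cancel-< p i<j))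
  ... | _ | new | new = <-irrefl refl j<k
  ... | new | new | _ = <-irrefl refl i<j
  ... | _ | new | old z = contradiction (1+k<shift j<k) (≤⇒≯ (proj₂ (position-∈ perm z)))
  ... | new | old y | _ = contradiction (1+k<shift i<j) (≤⇒≯ (proj₂ (position-∈ perm y)))

  remove : ∀ {n Q} → IsPerm (suc n) Q → Avoid Q →
           ∃[ p ] ∃[ q ] ∃[ P ] Q ↭ ins p q P × IsPerm n P × Avoid P × Valid₃₂₁ n P p q
  remove {n} {Q} perm avoid with at-position perm {suc n} (s≤s z≤n) ≤-refl
  ... | zero , x∈ = contradiction (proj₁ (value-∈ perm x∈)) λ ()
  ... | suc q , x∈ with ins-remove perm x∈
  ...   | P , Q↭ , permP = n , q , P , Q↭ , permP , avoid′ ∘ pattern-ins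
          , mkValid refl (≤-pred (proj₂ (value-∈ perm x∈))) λ x y q<a q<b i<j →
              value-≢⇒< permP x y i<j λ b<a → avoid′ (occurs (∈-ins⁺ x) (∈-ins⁺ y) (here refl)
                (shift-mono-< n i<j) (subst (_< suc n) (sym (shift-≤ (proj₂ (position-∈ permP y))))
                    (s≤s (proj₂ (position-∈ permP y))))
                (shift-mono-< q b<a) (subst (suc q <_) (sym (shift-> q<a)) (s≤s q<a))
                    (subst (suc q <_) (sym (shift-> q<b)) (s≤s q<b)))
    where
    avoid′ : Avoid (ins n q P)
    avoid′ = avoid ∘ pattern-resp-↭ (↭-sym Q↭)

  ins-unique : ∀ {n P p q P′ p′ q′} → IsPerm n P → Valid₃₂₁ n P p q → Valid₃₂₁ n P′ p′ q′ →
               ins p q P ↭ ins p′ q′ P′ → p ≡ p′ × q ≡ q′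
  ins-unique perm (mkValid refl q≤n _) (mkValid refl _ _) h
    with position-injective (ins-isPerm ≤-refl q≤n perm) (here refl)
        (Perm.∈-resp-↭ (↭-sym h) (here refl)) refl
  ... | refl = refl , refl

  -- Inserting at (n , q) keeps exactly the gaps at height at least q, moved up by one.
  valid-up : ∀ {n P q r} → IsPerm n P → q ≤ n → q ≤ r → Valid₃₂₁ n P n r →
      Valid₃₂₁ (suc n) (ins n q P) (suc n) (suc r)
  valid-up {n} {P} {q} {r} perm q≤n q≤r (mkValid _ r≤n right) = mkValid refl (s≤s r≤n) right′
    where
    right′ : ∀ {i a j b} → (i , a) ∈ ins n q P → (j , b) ∈ ins n q P → suc r < a → suc r < b → i < j → a < b
    right′ x∈ y∈ r<a r<b i<j with ∈-ins⁻ x∈ | ∈-ins⁻ y∈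
    ... | new | _ = contradiction (≤-pred r<a) (≤⇒≯ q≤r)
    ... | old _ | new = contradiction (≤-pred r<b) (≤⇒≯ q≤r)
    ... | old {a = a} x | old {a = b} y = shift-mono-< q
      (right x y (≤-pred (≤-trans r<a (shift≤1+m q a))) (≤-pred (≤-trans r<b (shift≤1+m q b)))
          (shift-cancel-< n i<j))

  valid-down : ∀ {n P q r} → q ≤ r → r ≤ n → Valid₃₂₁ (suc n) (ins n q P) (suc n) (suc r) → Valid₃₂₁ n P n r
  valid-down {n} {P} {q} {r} q≤r r≤n (mkValid _ _ right) =
      mkValid refl r≤n λ {i} {a} {j} {b} x y r<a r<b i<j →
    shift-cancel-< q (right (∈-ins⁺ x) (∈-ins⁺ y)
      (subst (suc r <_) (sym (shift-> (≤-<-trans q≤r r<a))) (s≤s r<a))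
      (subst (suc r <_) (sym (shift-> (≤-<-trans q≤r r<b))) (s≤s r<b)) (shift-mono-< n i<j))

  module _ {n P a p} (G : Gaps Valid₃₂₁ n P a p) where
    p-const : ∀ {t} → t ≤ a → p t ≡ n
    p-const t≤a = Valid₃₂₁.p≡n (proj₂ (proj₂ (Gaps.valid G t≤a)))

  -- Appending n + 1 disturbs no increasing order: old gaps keep their heights and gain one unit of
  -- distance, and the height n + 1 is new at distance 0.
  gaps-0 : ∀ {n P a p} → IsPerm n P → Gaps Valid₃₂₁ n P a p →
           Gaps Valid₃₂₁ (suc n) (ins (p 0) (p 0) P) (suc a) (next p 0)
  gaps-0 {n} {P} {a} {p} perm G rewrite p-const G z≤n = record
    { valid = valid′ ; complete = complete′ ; advance = advance′ }
    where
    open Gaps G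
    valid′ : ∀ {t} → t ≤ suc a → ∃[ q ] q + t ≡ next p 0 t × Valid₃₂₁ (suc n) (ins n n P) (next p 0 t) q
    valid′ {zero} _ rewrite p-const G z≤n = suc n , +-identityʳ (suc n) , mkValid refl ≤-refl λ x∈ _ q<a _ _ →
      contradiction (proj₂ (value-∈ (ins-isPerm {q = n} ≤-refl ≤-refl perm) x∈)) (<⇒≱ q<a)
    valid′ {suc t} (s≤s t≤a) with valid t≤a
    ... | q , q+t , mkValid e q≤n right rewrite p-const G t≤a =
        q , trans (+-suc q t) (cong suc q+t) , mkValid refl (m≤n⇒m≤1+n q≤n) right′
      where
      right′ : ∀ {i a j b} → (i , a) ∈ ins n n P → (j , b) ∈ ins n n P → q < a → q < b → i < j → a < b
      right′ x∈ y∈ q<a q<b i<j with ∈-ins⁻ x∈ | ∈-ins⁻ y∈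
      ... | new | new = contradiction i<j (<-irrefl refl)
      ... | new | old y = contradiction (1+k<shift i<j) (≤⇒≯ (proj₂ (position-∈ perm y)))
      ... | old x | new = subst (_< suc n) (sym (shift-≤ (proj₂ (value-∈ perm x))))
          (s≤s (proj₂ (value-∈ perm x)))
      ... | old x | old y = shift-mono-< n (right x y
        (subst (q <_) (shift-≤ (proj₂ (value-∈ perm x))) q<a)
            (subst (q <_) (shift-≤ (proj₂ (value-∈ perm y))) q<b) (shift-cancel-< n i<j))
    complete′ : ∀ {p′ q′} → Valid₃₂₁ (suc n) (ins n n P) p′ q′ →
        ∃[ t ] t ≤ suc a × p′ ≡ next p 0 t × q′ + t ≡ p′
    complete′ {q′ = q′} (mkValid refl q≤ right) with m≤n⇒m<n∨m≡n q≤
    ... | inj₂ refl = 0 , z≤n , cong suc (sym (p-const G z≤n)) , +-identityʳ _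
    ... | inj₁ (s≤s q≤n) with complete {n} {q′} (mkValid refl q≤n λ x y q<a q<b i<j → shift-cancel-< n
              (right (∈-ins⁺ x) (∈-ins⁺ y) (≤-trans q<a (m≤shift n _)) (≤-trans q<b (m≤shift n _))
                  (shift-mono-< n i<j)))
    ...   | t , t≤a , e , q+t = suc t , s≤s t≤a , cong suc e , trans (+-suc q′ t) (cong suc q+t)
    advance′ : ∀ {t} → t < suc a → next p 0 t ≤ next p 0 (suc t) × next p 0 (suc t) ≤ suc (next p 0 t)
    advance′ {zero} _ = ≤-refl , n≤1+n _
    advance′ {suc t} (s≤s t<a) = s≤s (proj₁ (advance t<a)) , s≤s (proj₂ (advance t<a))

  -- Gaps at height q or more rise together with n and keep their distance. In the result, heights
  -- up to q are lost: the old value q + 1 has become q + 2 and precedes the new last entry q + 1.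
  gaps-suc : ∀ {n P a p q s} → IsPerm n P → Gaps Valid₃₂₁ n P a p → suc s ≤ a → q + suc s ≡ p (suc s) →
             Gaps Valid₃₂₁ (suc n) (ins (p (suc s)) q P) (suc s) (next p (suc s))
  gaps-suc {n} {P} {a} {p} {q} {s} perm G s≤a q+s rewrite p-const G s≤a = record
    { valid = valid′ ; complete = complete′
    ; advance = λ t<s → s≤s (proj₁ (advance (<-≤-trans t<s s≤a)))
        , s≤s (proj₂ (advance (<-≤-trans t<s s≤a))) }
    where
    open Gaps G
    q<n : q < n
    q<n = subst (q <_) q+s (m<m+n q (s≤s z≤n))
    valid′ : ∀ {t} → t ≤ suc s → ∃[ r ] r + t ≡ suc (p t) × Valid₃₂₁ (suc n) (ins n q P) (suc (p t)) r
    valid′ {t} t≤s with valid (≤-trans t≤s s≤a)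
    ... | r , r+t , v rewrite p-const G (≤-trans t≤s s≤a) =
        suc r , cong suc r+t , valid-up perm (<⇒≤ q<n) q≤r v
      where
      q≤r : q ≤ r
      q≤r = +-cancelʳ-≤ t q r (≤-trans (+-monoʳ-≤ q t≤s) (≤-reflexive (trans q+s (sym r+t))))
    complete′ : ∀ {p′ q′} → Valid₃₂₁ (suc n) (ins n q P) p′ q′ →
        ∃[ t ] t ≤ suc s × p′ ≡ next p (suc s) t × q′ + t ≡ p′
    complete′ {q′ = q′} v@(mkValid refl q≤ right) with q′ ≤? q
    complete′ {q′ = suc r} v@(mkValid refl r≤ right) | no r≰q
        with complete (valid-down (≤-pred (≰⇒> r≰q)) (≤-pred r≤) v)
    ... | t , t≤a , e , r+t = t , +-cancelˡ-≤ q t (suc s)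
        (≤-trans (+-monoˡ-≤ t (≤-pred (≰⇒> r≰q))) (≤-reflexive (trans r+t (sym q+s))))
                            , cong suc e , cong suc r+t
    complete′ {q′ = zero} _ | no r≰q = contradiction z≤n r≰q
    complete′ {q′ = q′} (mkValid refl q≤ right) | yes q′≤q with at-value perm {suc q} (s≤s z≤n) q<n
    ... | i , x = contradiction
      (right (∈-ins⁺ x) (here refl) (subst (q′ <_) (sym (shift-> ≤-refl)) (m<n⇒m<1+n (s≤s q′≤q))) (s≤s q′≤q)
        (subst (_< suc n) (sym (shift-≤ (proj₂ (position-∈ perm x)))) (s≤s (proj₂ (position-∈ perm x)))))
      (≤⇒≯ (≤-trans (n≤1+n _) (≤-reflexive (sym (shift-> ≤-refl)))))

  -- The windows of the child lie above q, so a fixed point in them would come from an old point (b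
  -- + 1, b) with b > q, against `no-low`.
  no-fixed : ∀ {n P a p q s} → IsPerm n P → Gaps Valid₃₂₁ n P a p → suc s ≤ a → q + suc s ≡ p (suc s) →
             ∀ {t q′} → t ≤ suc s → q′ + t ≡ next p (suc s) t →
             ∀ {i b} → (i , b) ∈ ins (p (suc s)) q P → q′ < i → i ≤ next p (suc s) t → i ≢ b
  no-fixed {n} {P} {a} {p} {q} {s} perm G s≤a q+s {t} {q′} t≤s q′+t x∈ q′<i _
    with Gaps.valid G s≤a
  ... | r , r+s , v with +-cancelʳ-≡ (suc s) q r (trans q+s (sym r+s))
  ...   | refl = go (∈-ins⁻ x∈) q′<i
    where
    p≡n = p-const G s≤a
    q<q′ : q < q′
    q<q′ = +-cancelʳ-< t q q′ (≤-<-trans (+-monoʳ-≤ q t≤s)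
        (≤-reflexive (trans (cong suc q+s)
        (trans (cong suc (trans p≡n (sym (p-const G (≤-trans t≤s s≤a))))) (sym q′+t)))))
    go : ∀ {i b} → Ins (p (suc s)) q P (i , b) → q′ < i → i ≢ b
    go new _ e = contradiction (trans q+s (suc-injective e)) (m+1+n≢m q)
    go (old {i} {b} x) q′<i e with shift (p (suc s)) i | shift-view (p (suc s)) i | shift q b | shift-view q b
    ... | _ | high h | _ | _ = contradiction (proj₂ (position-∈ perm x)) (<⇒≱ (subst (_< i) p≡n h))
    ... | _ | low h | _ | low k = <⇒≱ (<-trans q<q′ q′<i) (subst (_≤ q) (sym e) k)
    ... | _ | low h | _ | high k = 1+n≰n
        (subst (_≤ b) e (no-low perm v x (<-trans q<q′ q′<i) h k
        (≤-trans (≤-trans (n≤1+n b) (≤-reflexive (sym e))) h)))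

  class : Class
  class = record
    { Avoid = Avoid
    ; Valid = Valid₃₂₁
    ; avoid-[] = λ { (occurs () _ _ _ _ _ _ _) }
    ; valid-resp-↭ = λ { h (mkValid e q≤n right) → mkValid e q≤n λ x y →
        right (Perm.∈-resp-↭ (↭-sym h) x) (Perm.∈-resp-↭ (↭-sym h) y) }
    ; valid-≤ = λ { (mkValid refl q≤n _) → q≤n , ≤-refl }
    ; no-low = no-low
    ; avoid-ins = avoid-ins
    ; remove = remove
    ; ins-unique = ins-unique
    ; next = next
    ; next-suc = λ _ _ → refl
    ; gaps-[] = record
        { valid = λ { z≤n → 0 , refl , mkValid refl z≤n λ () }
        ; complete = λ { (mkValid refl z≤n _) → 0 , z≤n , refl , refl }
        ; advance = λ () }
    ; gaps-0 = gaps-0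
    ; gaps-suc = gaps-suc
    ; no-fixed = no-fixed
    }

-- A permutation avoiding 132 is built by inserting its first weak deficiency,
-- which is always a left-to-right minimum.

record Valid₁₃₂ (n : ℕ) (P : List Point) (p q : ℕ) : Set where
  constructor mkValid
  field
    q≤p : q ≤ p
    p≤n : p ≤ n
    left : ∀ {i a} → (i , a) ∈ P → i ≤ p → q < a × i ≤ a
    right : ∀ {i a j b} → (i , a) ∈ P → (j , b) ∈ P → p < i → q < a → q < b → i < j → a < b

module Class₁₃₂ where

  Avoid : List Point → Set
  Avoid P = ¬ HasPattern 1 3 2 P

  -- For s = 0 the corner below the new point is the gap at distance 0 and the old gaps move one to
  -- the right. For s > 0 the old gap at distance t + 1 is raised and comes one closer; the minimum
  -- makes the last distance repeat the position of the corner.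
  next : (ℕ → ℕ) → ℕ → ℕ → ℕ
  next p zero zero = p 0
  next p zero (suc t) = suc (p t)
  next p (suc s) t = p (suc (t ⊓ s))

  -- As the 1 of a 132 the new entry is excluded by `right`; as the 3 or the 2 it would need a
  -- smaller entry to its left, against `left`.
  avoid-ins : ∀ {n P p q} → IsPerm n P → Avoid P → Valid₁₃₂ n P p q → Avoid (ins p q P)
  avoid-ins {p = p} {q} _ avoid (mkValid q≤p p≤n left right) (occurs x∈ y∈ z∈ i<j j<k a<b a<c c<b)
    with ∈-ins⁻ x∈ | ∈-ins⁻ y∈ | ∈-ins⁻ z∈
  ... | old x | old y | old z = avoid (occurs x y z (shift-cancel-< p i<j) (shift-cancel-< p j<k)
                                    (shift-cancel-< q a<b) (shift-cancel-< q a<c) (shift-cancel-< q c<b))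
  ... | new | old y | old z = <-asym (shift-cancel-< q c<b)
    (right y z (1+k<shift i<j) (1+k<shift a<b) (1+k<shift a<c) (shift-cancel-< p j<k))
  ... | old x | new | _ = contradiction (shift<1+k a<b) (<⇒≱ (proj₁ (left x (shift<1+k i<j))))
  ... | old x | old y | new = contradiction (shift<1+k a<c)
      (<⇒≱ (proj₁ (left x (shift<1+k (<-trans i<j j<k)))))
  ... | new | new | _ = <-irrefl refl i<j
  ... | new | old _ | new = <-irrefl refl (<-trans i<j j<k)

  first-weak-deficiency : ∀ {n Q} → IsPerm n Q → ∀ m → m ≤ n →
    (∃[ i ] ∃[ a ] (i , a) ∈ Q × a ≤ i × (∀ {j b} → (j , b) ∈ Q → j < i → j < b))
    ⊎ (∀ {j b} → (j , b) ∈ Q → j ≤ m → j < b)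
  first-weak-deficiency perm zero _ = inj₂ λ y∈ j≤0 →
      contradiction (≤-trans (proj₁ (position-∈ perm y∈)) j≤0) λ ()
  first-weak-deficiency perm (suc m) m<n with first-weak-deficiency perm m (<⇒≤ m<n)
  ... | inj₁ found = inj₁ found
  ... | inj₂ none with at-position perm {suc m} (s≤s z≤n) m<n
  ...   | a , x∈ with a ≤? suc m
  ...     | yes a≤ = inj₁ (suc m , a , x∈ , a≤ , λ y∈ j<i → none y∈ (≤-pred j<i))
  ...     | no a≰ = inj₂ none′
    where
    none′ : ∀ {j b} → (j , b) ∈ _ → j ≤ suc m → j < b
    none′ y∈ j≤ with m≤n⇒m<n∨m≡n j≤
    ... | inj₁ j<1+m = none y∈ (≤-pred j<1+m)
    ... | inj₂ refl with position-injective perm x∈ y∈ refl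
    ...   | refl = ≰⇒> a≰

  -- Otherwise a smaller entry before it, the entry just before it (an excedance) and itself form 132.
  left-to-right-minimum : ∀ {n Q i a} → IsPerm n Q → Avoid Q → (i , a) ∈ Q → a ≤ i →
    (∀ {j b} → (j , b) ∈ Q → j < i → j < b) → ∀ {j b} → (j , b) ∈ Q → j < i → a < b
  left-to-right-minimum {i = suc p} {a} perm avoid x∈ a≤i before {j} {b} y∈ j<i with <-cmp b a
  ... | tri> _ _ a<b = a<b
  ... | tri≈ _ refl _ = contradiction (cong proj₁ (value-injective perm y∈ x∈ refl)) (<⇒≢ j<i)
  ... | tri< b<a _ _ with at-position perm (≤-trans (proj₁ (position-∈ perm y∈)) (≤-pred j<i))
                            (≤-trans (n≤1+n p) (proj₂ (position-∈ perm x∈)))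
  ...   | w , w∈ with m≤n⇒m<n∨m≡n (≤-pred j<i)
  ...     | inj₁ j<p = contradiction (occurs y∈ w∈ x∈ j<p ≤-refl (<-≤-trans b<a (<⇒≤ a<w)) b<a a<w) avoid
    where
    a<w : a < w
    a<w = ≤∧≢⇒< (≤-trans a≤i (before w∈ ≤-refl)) λ a≡w → 1+n≢n (cong proj₁ (value-injective perm x∈ w∈ a≡w))
  ...     | inj₂ refl with position-injective perm y∈ w∈ refl
  ...       | refl = contradiction b<a (≤⇒≯ (≤-trans a≤i (before w∈ ≤-refl)))

  remove : ∀ {n Q} → IsPerm (suc n) Q → Avoid Q →
           ∃[ p ] ∃[ q ] ∃[ P ] Q ↭ ins p q P × IsPerm n P × Avoid P × Valid₁₃₂ n P p q
  remove {n} {Q} perm avoid with first-weak-deficiency perm (suc n) ≤-refl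
  ... | inj₂ none with at-position perm {suc n} (s≤s z≤n) ≤-refl
  -- The last position cannot hold an excedance.
  ...   | a , x∈ = contradiction (none x∈ ≤-refl) (≤⇒≯ (proj₂ (value-∈ perm x∈)))
  remove {n} {Q} perm avoid | inj₁ (zero , a , x∈ , _) = contradiction (proj₁ (position-∈ perm x∈)) λ ()
  remove {n} {Q} perm avoid | inj₁ (suc p , zero , x∈ , _) = contradiction (proj₁ (value-∈ perm x∈)) λ ()
  remove {n} {Q} perm avoid | inj₁ (suc p , suc q , x∈ , s≤s q≤p , before) with ins-remove perm x∈
  ... | P , Q↭ , permP = p , q , P , Q↭ , permP , avoid′ ∘ pattern-ins
        , mkValid q≤p (≤-pred (proj₂ (position-∈ perm x∈))) left right
    where
    avoid′ : Avoid (ins p q P)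
    avoid′ = avoid ∘ pattern-resp-↭ (↭-sym Q↭)
    left : ∀ {i a} → (i , a) ∈ P → i ≤ p → q < a × i ≤ a
    left {i} {a} y i≤p = q<a , ≤-pred (subst₂ _<_ (shift-≤ i≤p) (shift-> q<a) (before y∈ i<))
      where
      y∈ = Perm.∈-resp-↭ (↭-sym Q↭) (∈-ins⁺ y)
      i< : shift p i < suc p
      i< = subst (_< suc p) (sym (shift-≤ i≤p)) (s≤s i≤p)
      q<a = 1+k<shift (left-to-right-minimum perm avoid x∈ (s≤s q≤p) before y∈ i<)
    right : ∀ {i a j b} → (i , a) ∈ P → (j , b) ∈ P → p < i → q < a → q < b → i < j → a < b
    right x y p<i q<a q<b i<j = value-≢⇒< permP x y i<j λ b<a → avoid′
      (occurs (here refl) (∈-ins⁺ x) (∈-ins⁺ y) (subst (suc p <_) (sym (shift-> p<i)) (s≤s p<i))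
          (shift-mono-< p i<j)
        (subst (suc q <_) (sym (shift-> q<a)) (s≤s q<a)) (subst (suc q <_) (sym (shift-> q<b)) (s≤s q<b))
            (shift-mono-< q b<a))

  -- The old points up to position p are raised to strict excedances, so no weak deficiency of the
  -- result precedes the new point.
  new-first : ∀ {n P p q p′ q′} → Valid₁₃₂ n P p q → q′ ≤ p′ → (suc p′ , suc q′) ∈ ins p q P → p ≤ p′
  new-first {p = p} {q} {p′} {q′} (mkValid _ _ left _) q′≤p′ x∈ = go (∈-ins⁻ x∈) refl refl
    where
    go : ∀ {i a} → Ins p q _ (i , a) → i ≡ suc p′ → a ≡ suc q′ → p ≤ p′
    go new refl _ = ≤-refl
    go (old {i} {a} x) e f with i ≤? p
    ... | no i≰p = ≤-pred (≤-trans (≰⇒> i≰p) (≤-trans (m≤shift p i) (≤-reflexive e)))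
    ... | yes i≤p with left x i≤p
    ...   | q<a , i≤a = contradiction (subst₂ _≤_ (trans (sym (shift-≤ i≤p)) e)
        (suc-injective (trans (sym (shift-> q<a)) f)) i≤a) (≤⇒≯ q′≤p′)

  ins-unique : ∀ {n P p q P′ p′ q′} → IsPerm n P → Valid₁₃₂ n P p q → Valid₁₃₂ n P′ p′ q′ →
               ins p q P ↭ ins p′ q′ P′ → p ≡ p′ × q ≡ q′
  ins-unique perm v@(mkValid q≤p p≤n _ _) v′@(mkValid q′≤p′ _ _ _) h
    with ≤-antisym (new-first v q′≤p′ (Perm.∈-resp-↭ (↭-sym h) (here refl)))
        (new-first v′ q≤p (Perm.∈-resp-↭ h (here refl)))
  ... | refl with position-injective (ins-isPerm p≤n (≤-trans q≤p p≤n) perm) (here refl)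
      (Perm.∈-resp-↭ (↭-sym h) (here refl)) refl
  ...   | refl = refl , refl

  -- Among the points to the right of p and above q the new one comes first and is lowest, so their
  -- increasing order persists.
  valid-same : ∀ {n P p q} → Valid₁₃₂ n P p q → Valid₁₃₂ (suc n) (ins p q P) p q
  valid-same {n} {P} {p} {q} (mkValid q≤p p≤n left right) = mkValid q≤p (m≤n⇒m≤1+n p≤n) (left′ ∘ ∈-ins⁻)
    λ x∈ y∈ → right′ (∈-ins⁻ x∈) (∈-ins⁻ y∈)
    where
    left′ : ∀ {i a} → Ins p q P (i , a) → i ≤ p → q < a × i ≤ a
    left′ new i≤p = contradiction i≤p 1+n≰n
    left′ (old {i} {a} x) i≤p with left x (≤-trans (m≤shift p i) i≤p)
    ... | q<a , i≤a rewrite shift-> q<a =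
        m<n⇒m<1+n q<a , ≤-trans (≤-reflexive (shift-≤ (≤-trans (m≤shift p i) i≤p))) (m≤n⇒m≤1+n i≤a)
    right′ : ∀ {i a j b} → Ins p q P (i , a) → Ins p q P (j , b) → p < i → q < a → q < b → i < j → a < b
    right′ new new _ _ _ i<j = contradiction i<j (<-irrefl refl)
    right′ new (old {a = b} y) _ _ q<b _ = subst (suc q <_) (sym (shift-> (k<shift q<b))) (s≤s (k<shift q<b))
    right′ (old x) new p<i _ _ i<j = contradiction (shift<1+k i<j) (<⇒≱ (k<shift p<i))
    right′ (old x) (old y) p<i q<a q<b i<j =
        shift-mono-< q (right x y (k<shift p<i) (k<shift q<a) (k<shift q<b) (shift-cancel-< p i<j))

  -- A gap of the new permutation weakly to the left of and below the insertion point is that point: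
  -- the entries at position p and of value q would violate `right` otherwise.
  valid-corner : ∀ {n P p q p′ q′} → IsPerm n P → Valid₁₃₂ n P p q → Valid₁₃₂ (suc n) (ins p q P) p′ q′ →
                 p′ ≤ p → q′ ≤ q → p′ ≡ p × q′ ≡ q
  valid-corner {n} {P} {p} {q} {p′} {q′} perm (mkValid q≤p p≤n left right) (mkValid _ _ _ right′) p′≤p q′≤q =
      p′≡p , q′≡q
    where
    p′≡p : p′ ≡ p
    p′≡p with m≤n⇒m<n∨m≡n p′≤p
    ... | inj₂ e = e
    ... | inj₁ p′<p with at-position perm (≤-trans (s≤s z≤n) p′<p) p≤n
    ...   | w , x with left x ≤-refl
    ...     | q<w , _ = contradiction
      (right′ (∈-ins⁺ x) (here refl) (<-≤-trans p′<p (m≤shift p p))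
          (≤-<-trans q′≤q (<-≤-trans q<w (m≤shift q w))) (s≤s q′≤q)
        (subst (_< suc p) (sym (shift-≤ ≤-refl)) ≤-refl))
      (≤⇒≯ (≤-trans q<w (m≤shift q w)))
    q′≡q : q′ ≡ q
    q′≡q with m≤n⇒m<n∨m≡n q′≤q
    ... | inj₂ e = e
    ... | inj₁ q′<q with at-value perm (≤-trans (s≤s z≤n) q′<q) (≤-trans q≤p p≤n)
    ...   | i , x = contradiction
      (right′ (here refl) (∈-ins⁺ x) (s≤s p′≤p) (s≤s q′≤q) (<-≤-trans q′<q (m≤shift q q))
        (subst (suc p <_) (sym (shift-> p<i)) (s≤s p<i)))
      (≤⇒≯ (≤-trans (≤-reflexive (shift-≤ ≤-refl)) (n≤1+n q)))
      where
      p<i : p < i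
      p<i = ≰⇒> λ i≤p → <-irrefl refl (proj₁ (left x i≤p))

  -- All old gaps satisfy q ≤ k ≤ p. Moved one to the right, they have the new fixed point on their
  -- left, where `left` admits it; no gap weakly to the left of the new point exists besides its
  -- corner.
  gaps-0 : ∀ {n P a p} → IsPerm n P → Gaps Valid₁₃₂ n P a p →
           Gaps Valid₁₃₂ (suc n) (ins (p 0) (p 0) P) (suc a) (next p 0)
  gaps-0 {n} {P} {a} {p} perm G = record { valid = valid′ ; complete = complete′ ; advance = advance′ }
    where
    open Gaps G
    open Gaps-mono p advance
    k = p 0
    valid-k : Valid₁₃₂ n P k k
    valid-k with valid z≤n
    ... | q , q+0 , v rewrite sym (trans (sym (+-identityʳ q)) q+0) = v
    valid′ : ∀ {t} → t ≤ suc a → ∃[ q ] q + t ≡ next p 0 t × Valid₁₃₂ (suc n) (ins k k P) (next p 0 t) q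
    valid′ {zero} _ = k , +-identityʳ k , valid-same valid-k
    valid′ {suc t} (s≤s t≤a) with valid t≤a
    ... | q , q+t , mkValid q≤p p≤n left right = q , trans (+-suc q t) (cong suc q+t)
          , mkValid (m≤n⇒m≤1+n q≤p) (s≤s p≤n) (left′ ∘ ∈-ins⁻) λ x∈ y∈ → right′ (∈-ins⁻ x∈) (∈-ins⁻ y∈)
      where
      q≤k : q ≤ k
      q≤k = q-anti z≤n t≤a (+-identityʳ k) q+t
      k≤p : k ≤ p t
      k≤p = p-mono z≤n t≤a
      position-≤ : ∀ {i} → shift k i ≤ suc (p t) → i ≤ p t
      position-≤ {i} h with shift k i | shift-view k i
      ... | _ | low i≤k = ≤-trans i≤k k≤p
      ... | _ | high _ = ≤-pred h
      value-> : ∀ {a} → q < shift k a → q < a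
      value-> {a} h with shift k a | shift-view k a
      ... | _ | low _ = h
      ... | _ | high k<a = ≤-<-trans q≤k k<a
      left′ : ∀ {i a} → Ins k k P (i , a) → i ≤ suc (p t) → q < a × i ≤ a
      left′ new _ = s≤s q≤k , ≤-refl
      left′ (old {i} {a} x) h with left x (position-≤ h)
      ... | q<a , i≤a = <-≤-trans q<a (m≤shift k a) , shift-mono-≤ k i≤a
      right′ : ∀ {i a j b} → Ins k k P (i , a) → Ins k k P (j , b) → suc (p t) < i → q < a → q < b →
          i < j → a < b
      right′ new _ p<i _ _ _ = contradiction (≤-pred p<i) (≤⇒≯ k≤p)
      right′ (old _) new p<i _ _ i<j = contradiction (<-trans p<i i<j) (≤⇒≯ (s≤s k≤p))
      right′ (old {i} x) (old y) p<i q<a q<b i<j = shift-mono-< k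
        (right x y (≤-pred (≤-trans p<i (shift≤1+m k i))) (value-> q<a) (value-> q<b) (shift-cancel-< k i<j))
    complete′ : ∀ {p′ q′} → Valid₁₃₂ (suc n) (ins k k P) p′ q′ →
        ∃[ t ] t ≤ suc a × p′ ≡ next p 0 t × q′ + t ≡ p′
    complete′ {p′} {q′} v@(mkValid q≤p p≤n left right) with p′ ≤? k
    ... | yes p′≤k with valid-corner perm valid-k v p′≤k (≤-trans q≤p p′≤k)
    ...   | refl , refl = 0 , z≤n , refl , +-identityʳ _
    complete′ {zero} _ | no p≰k = contradiction z≤n p≰k
    complete′ {suc p₀} {q′} v@(mkValid q≤p p≤n left right) | no p≰k =
      let t , t≤a , e , q+t = complete {p₀} {q′} (mkValid (≤-trans q≤k k≤p₀) (≤-pred p≤n) left₀ right₀)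
      in suc t , s≤s t≤a , cong suc e , trans (+-suc q′ t) (cong suc q+t)
      where
      k≤p₀ : k ≤ p₀
      k≤p₀ = ≤-pred (≰⇒> p≰k)
      q≤k : q′ ≤ k
      q≤k = ≤-pred (proj₁ (left (here refl) (s≤s k≤p₀)))
      left₀ : ∀ {i a} → (i , a) ∈ P → i ≤ p₀ → q′ < a × i ≤ a
      left₀ {i} {a} x i≤p with left (∈-ins⁺ x) (≤-trans (shift≤1+m k i) (s≤s i≤p))
      ... | q<a , i≤a with a ≤? k
      ...   | yes a≤k = subst (q′ <_) (shift-≤ a≤k) q<a , shift-cancel-≤ k i≤a
      ...   | no a≰k = ≤-<-trans q≤k (≰⇒> a≰k) , shift-cancel-≤ k i≤a
      right₀ : ∀ {i a j b} → (i , a) ∈ P → (j , b) ∈ P → p₀ < i → q′ < a → q′ < b → i < j → a < b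
      right₀ {i} {a} {j} {b} x y p<i q<a q<b i<j = shift-cancel-< k
        (right (∈-ins⁺ x) (∈-ins⁺ y) (subst (suc p₀ <_) (sym (shift-> (≤-<-trans k≤p₀ p<i))) (s≤s p<i))
          (<-≤-trans q<a (m≤shift k a)) (<-≤-trans q<b (m≤shift k b)) (shift-mono-< k i<j))
    advance′ : ∀ {t} → t < suc a → next p 0 t ≤ next p 0 (suc t) × next p 0 (suc t) ≤ suc (next p 0 t)
    advance′ {zero} _ = n≤1+n _ , ≤-refl
    advance′ {suc t} (s≤s t<a) = s≤s (proj₁ (advance t<a)) , s≤s (proj₂ (advance t<a))

  module _ {n P a p q s} (G : Gaps Valid₁₃₂ n P a p) (s<a : suc s ≤ a) (q+s : q + suc s ≡ p (suc s)) where
    open Gaps G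
    open Gaps-mono p advance

    valid-at : Valid₁₃₂ n P (p (suc s)) q
    valid-at with valid s<a
    ... | r , r+s , v rewrite +-cancelʳ-≡ (suc s) q r (trans q+s (sym r+s)) = v

    next-≤ : ∀ t → next p (suc s) t ≤ p (suc s)
    next-≤ t = p-mono (s≤s (m⊓n≤n t s)) s<a

  -- A gap to the right of the new point would need it to be a weak excedance, and a gap at height
  -- at most q is the corner. The others are old gaps raised by one.
  gaps-suc : ∀ {n P a p q s} → IsPerm n P → Gaps Valid₁₃₂ n P a p → suc s ≤ a → q + suc s ≡ p (suc s) →
             Gaps Valid₁₃₂ (suc n) (ins (p (suc s)) q P) (suc s) (next p (suc s))
  gaps-suc {n} {P} {a} {p} {q} {s} perm G s<a q+s =
      record { valid = valid′ ; complete = complete′ ; advance = advance′ }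
    where
    open Gaps G
    open Gaps-mono p advance
    k = p (suc s)
    v₀ = valid-at G s<a q+s
    q<k : q < k
    q<k = subst (q <_) q+s (m<m+n q (s≤s z≤n))
    valid′ : ∀ {t} → t ≤ suc s → ∃[ r ] r + t ≡ next p (suc s) t
        × Valid₁₃₂ (suc n) (ins k q P) (next p (suc s) t) r
    valid′ {t} t≤ with m≤n⇒m<n∨m≡n t≤
    ... | inj₂ refl rewrite m≥n⇒m⊓n≡n (n≤1+n s) = q , q+s , valid-same v₀
    ... | inj₁ (s≤s t≤s) rewrite m≤n⇒m⊓n≡m t≤s with valid (≤-trans (s≤s t≤s) s<a)
    ...   | r , r+t , mkValid r≤p p≤n left right = suc r , r+t′
            , mkValid (subst (suc r ≤_) r+t′ (m≤m+n (suc r) t)) (m≤n⇒m≤1+n p≤n) (left′ ∘ ∈-ins⁻) λ x∈ y∈ →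
                right′ (∈-ins⁻ x∈) (∈-ins⁻ y∈)
      where
      r+t′ : suc r + t ≡ p (suc t)
      r+t′ = trans (sym (+-suc r t)) r+t
      q≤r : q ≤ r
      q≤r = q-anti (s≤s t≤s) s<a r+t q+s
      pₜ≤k : p (suc t) ≤ k
      pₜ≤k = p-mono (s≤s t≤s) s<a
      left′ : ∀ {i a} → Ins k q P (i , a) → i ≤ p (suc t) → suc r < a × i ≤ a
      left′ new h = contradiction (≤-trans h pₜ≤k) 1+n≰n
      left′ (old {i} {a} x) h with left x (≤-trans (m≤shift k i) h)
      ... | r<a , i≤a rewrite shift-> (≤-<-trans q≤r r<a)
          | shift-≤ {k} {i} (≤-trans (≤-trans (m≤shift k i) h) pₜ≤k) = s≤s r<a , m≤n⇒m≤1+n i≤a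
      position-> : ∀ {i} → p (suc t) < shift k i → p (suc t) < i
      position-> {i} h with shift k i | shift-view k i
      ... | _ | low _ = h
      ... | _ | high k<i = ≤-<-trans pₜ≤k k<i
      right′ : ∀ {i a j b} → Ins k q P (i , a) → Ins k q P (j , b) → p (suc t) < i → suc r < a → suc r < b →
          i < j → a < b
      right′ new _ _ r<a _ _ = contradiction (≤-pred r<a) (≤⇒≯ q≤r)
      right′ (old _) new _ _ r<b _ = contradiction (≤-pred r<b) (≤⇒≯ q≤r)
      right′ (old {a = a} x) (old {a = b} y) p<i r<a r<b i<j = shift-mono-< q
        (right x y (position-> p<i) (≤-pred (≤-trans r<a (shift≤1+m q a)))
            (≤-pred (≤-trans r<b (shift≤1+m q b))) (shift-cancel-< k i<j))
    complete′ : ∀ {p′ q′} → Valid₁₃₂ (suc n) (ins k q P) p′ q′ →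
        ∃[ t ] t ≤ suc s × p′ ≡ next p (suc s) t × q′ + t ≡ p′
    complete′ {p′} {q′} v@(mkValid q′≤p′ p′≤n left right) with p′ ≤? k | q′ ≤? q
    ... | no p′≰k | _ = contradiction (proj₂ (left (here refl) (≰⇒> p′≰k))) (<⇒≱ (s≤s q<k))
    ... | yes p′≤k | yes q′≤q with valid-corner perm v₀ v p′≤k q′≤q
    ...   | refl , refl = suc s , ≤-refl , cong (p ∘ suc) (sym (m≥n⇒m⊓n≡n (n≤1+n s))) , q+s
    complete′ {p′} {zero} v | yes p′≤k | no q′≰q = contradiction z≤n q′≰q
    complete′ {p′} {suc r} v@(mkValid r<p′ p′≤n left right) | yes p′≤k | no q′≰q =
      found (complete {p′} {r} (mkValid (<⇒≤ r<p′) (≤-trans p′≤k (Valid₁₃₂.p≤n v₀)) left₀ right₀))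
      where
      q≤r : q ≤ r
      q≤r = ≤-pred (≰⇒> q′≰q)
      left₀ : ∀ {i a} → (i , a) ∈ P → i ≤ p′ → r < a × i ≤ a
      left₀ {i} {a} x i≤p with left (∈-ins⁺ x) (≤-trans (≤-reflexive (shift-≤ (≤-trans i≤p p′≤k))) i≤p)
      ... | r<a , _ = ≤-pred (≤-trans r<a (shift≤1+m q a)) , proj₂ (Valid₁₃₂.left v₀ x (≤-trans i≤p p′≤k))
      right₀ : ∀ {i a j b} → (i , a) ∈ P → (j , b) ∈ P → p′ < i → r < a → r < b → i < j → a < b
      right₀ {i} {a} {j} {b} x y p<i r<a r<b i<j = shift-cancel-< q
        (right (∈-ins⁺ x) (∈-ins⁺ y) (<-≤-trans p<i (m≤shift k i))
          (subst (suc r <_) (sym (shift-> (≤-<-trans q≤r r<a))) (s≤s r<a))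
          (subst (suc r <_) (sym (shift-> (≤-<-trans q≤r r<b))) (s≤s r<b)) (shift-mono-< k i<j))
      found : ∃[ t ] t ≤ a × p′ ≡ p t × r + t ≡ p′ → ∃[ t ] t ≤ suc s × p′ ≡ next p (suc s) t × suc r + t ≡ p′
      -- Raised by one, the old gap at distance 0 would lie above the diagonal.
      found (zero , _ , _ , r+0) = contradiction r<p′ (≤⇒≯ (≤-reflexive (trans (sym r+0) (+-identityʳ r))))
      found (suc t , t≤a , e , r+t) = t , m≤n⇒m≤1+n t≤s , trans e (cong (p ∘ suc) (sym (m≤n⇒m⊓n≡m t≤s)))
          , trans (sym (+-suc r t)) r+t
        where
        t≤s : t ≤ s
        t≤s = ≤-pred (+-cancelˡ-≤ q (suc t) (suc s) (≤-trans (+-monoˡ-≤ (suc t) q≤r)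
                (≤-trans (≤-reflexive r+t) (≤-trans p′≤k (≤-reflexive (sym q+s))))))
    advance′ : ∀ {t} → t < suc s → next p (suc s) t ≤ next p (suc s) (suc t) × next p (suc s) (suc t)
        ≤ suc (next p (suc s) t)
    advance′ {t} (s≤s t≤s) with m≤n⇒m<n∨m≡n t≤s
    ... | inj₁ t<s rewrite m≤n⇒m⊓n≡m t≤s | m≤n⇒m⊓n≡m t<s = advance (<-≤-trans (s≤s t<s) s<a)
    ... | inj₂ refl rewrite ⊓-idem t | m≥n⇒m⊓n≡n (n≤1+n t) = ≤-refl , n≤1+n _

  -- All windows of the child end before the new point, where the insertion has made every point a
  -- strict excedance.
  no-fixed : ∀ {n P a p q s} → IsPerm n P → Gaps Valid₁₃₂ n P a p → suc s ≤ a → q + suc s ≡ p (suc s) →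
             ∀ {t q′} → t ≤ suc s → q′ + t ≡ next p (suc s) t →
             ∀ {i b} → (i , b) ∈ ins (p (suc s)) q P → q′ < i → i ≤ next p (suc s) t → i ≢ b
  no-fixed {p = p} {q} {s} perm G s<a q+s {t} _ _ x∈ _ i≤ with ∈-ins⁻ x∈
  ... | new = λ _ → 1+n≰n (≤-trans i≤ (next-≤ G s<a q+s t))
  ... | old {i} {b} x = λ e → 1+n≰n (≤-trans
      (≤-reflexive (trans (sym (shift-> q<b)) (trans (sym e) (shift-≤ i≤k)))) i≤b)
    where
    i≤k : i ≤ p (suc s)
    i≤k = ≤-trans (m≤shift _ i) (≤-trans i≤ (next-≤ G s<a q+s t))
    q<b = proj₁ (Valid₁₃₂.left (valid-at G s<a q+s) x i≤k)
    i≤b = proj₂ (Valid₁₃₂.left (valid-at G s<a q+s) x i≤k)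

  class : Class
  class = record
    { Avoid = Avoid
    ; Valid = Valid₁₃₂
    ; avoid-[] = λ { (occurs () _ _ _ _ _ _ _) }
    ; valid-resp-↭ = λ { h (mkValid q≤p p≤n left right) → mkValid q≤p p≤n
        (λ x → left (Perm.∈-resp-↭ (↭-sym h) x))
        (λ x y → right (Perm.∈-resp-↭ (↭-sym h) x) (Perm.∈-resp-↭ (↭-sym h) y)) }
    ; valid-≤ = λ { (mkValid q≤p p≤n _ _) → q≤p , p≤n }
    ; no-low = λ { _ (mkValid _ _ left _) x _ i≤p _ _ → proj₂ (left x i≤p) }
    ; avoid-ins = avoid-ins
    ; remove = remove
    ; ins-unique = ins-unique
    ; next = next
    ; next-suc = λ _ _ → refl
    ; gaps-[] = record
        { valid = λ { z≤n → 0 , refl , mkValid z≤n z≤n (λ ()) λ () }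
        ; complete = λ { (mkValid z≤n z≤n _ _) → 0 , z≤n , refl , refl }
        ; advance = λ () }
    ; gaps-0 = gaps-0
    ; gaps-suc = gaps-suc
    ; no-fixed = no-fixed
    }

-- Comparing counts

countB-++ : ∀ (p : A → Bool) xs ys → countB p (xs ++ ys) ≡ countB p xs + countB p ys
countB-++ p [] ys = refl
countB-++ p (x ∷ xs) ys with p x
... | true  = cong suc (countB-++ p xs ys)
... | false = countB-++ p xs ys

countB-map : ∀ (p : B → Bool) (f : A → B) xs → countB p (map f xs) ≡ countB (p ∘ f) xs
countB-map p f [] = refl
countB-map p f (x ∷ xs) with p (f x)
... | true  = cong suc (countB-map p f xs)
... | false = countB-map p f xs

-- Injection principle for a relation: the partner of the head is deleted from `ys`. Distinctness is
-- a parameter so that states, distinct only up to `↭`, are covered too.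
countB-≤ : ∀ {p : A → Bool} {q : B → Bool} {_≁_ : A → A → Set} {R : A → B → Set} {xs ys} →
  AllPairs _≁_ xs → (∀ {x} → x ∈ xs → T (p x) → ∃[ y ] y ∈ ys × T (q y) × R x y) →
  (∀ {x x′ y} → x ∈ xs → x′ ∈ xs → R x y → R x′ y → ¬ x ≁ x′) → countB p xs ≤ countB q ys
countB-≤ {xs = []} _ _ _ = z≤n
countB-≤ {p = p} {q} {_≁_} {R} {x ∷ xs} {ys} (x≁ ∷ d) total separate with p x in px
... | false = countB-≤ {R = R} d (total ∘ there) (λ x∈ x′∈ → separate (there x∈) (there x′∈))
... | true with total (here refl) (Equivalence.from T-≡ px)
...   | y , y∈ , qy , r with ∈-∃++ y∈
...     | as , bs , refl = begin
  suc (countB p xs)          ≤⟨ s≤s (countB-≤ {R = R} d total′ (λ x∈ x′∈ → separate (there x∈) (there x′∈))) ⟩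
  suc (countB q (as ++ bs))  ≡⟨ cong suc (countB-++ q as bs) ⟩
  suc (countB q as + countB q bs) ≡⟨ +-suc _ _ ⟨
  countB q as + suc (countB q bs) ≡⟨ cong (λ b → countB q as + (if b then suc (countB q bs) else countB q bs))
      (Equivalence.to T-≡ qy) ⟨
  countB q as + countB q (y ∷ bs) ≡⟨ countB-++ q as (y ∷ bs) ⟨
  countB q (as ++ y ∷ bs)    ∎
  where
  open ≤-Reasoning
  total′ : ∀ {x′} → x′ ∈ xs → T (p x′) → ∃[ y′ ] y′ ∈ as ++ bs × T (q y′) × R x′ y′
  total′ x′∈ px′ with total (there x′∈) px′
  ... | y′ , y′∈ , qy′ , r′ with ∈-++⁻ as y′∈
  ...   | inj₁ h = y′ , ∈-++⁺ˡ h , qy′ , r′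
  ...   | inj₂ (there h) = y′ , ∈-++⁺ʳ as h , qy′ , r′
  ...   | inj₂ (here refl) = contradiction (All.lookup x≁ x′∈) (separate (here refl) (there x′∈) r r′)

opaque
  unfolding 𝟙

  countB-∑ : ∀ (p : A → Bool) xs → countB p xs ≡ ∑ xs (𝟙 ∘ p)
  countB-∑ p [] = refl
  countB-∑ p (x ∷ xs) with p x
  ... | true  = cong suc (countB-∑ p xs)
  ... | false = countB-∑ p xs

  𝟙-∧ : ∀ b c → 𝟙 (b ∧ c) ≡ 𝟙 b * 𝟙 c
  𝟙-∧ true c = sym (+-identityʳ _)
  𝟙-∧ false c = refl

  𝟙-∨ : ∀ b c → (T b → ¬ T c) → 𝟙 (b ∨ c) ≡ 𝟙 b + 𝟙 c
  𝟙-∨ true true h = contradiction _ (h _)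
  𝟙-∨ true false h = refl
  𝟙-∨ false c h = refl

opaque
  unfolding 𝟙 lt le eq

  𝟙-< : ∀ m n → 𝟙 (m <ᵇ n) ≡ lt m n
  𝟙-< m n = refl

  𝟙-≤ : ∀ m n → 𝟙 (m ≤ᵇ n) ≡ le m n
  𝟙-≤ m n = refl

  𝟙-≡ : ∀ m n → 𝟙 (m ≡ᵇ n) ≡ eq m n
  𝟙-≡ m n = refl

-- One-line notation and graphs

-- Pigeonhole: deleting the elements of `xs` one by one from `ys` exhausts it, by the bound on
-- lengths.
unique-⊆⇒↭ : ∀ {xs ys : List A} → Unique xs → (∀ {x} → x ∈ xs → x ∈ ys) → length ys ≤ length xs → xs ↭ ys
unique-⊆⇒↭ {xs = []} {[]} _ _ _ = ↭-refl
unique-⊆⇒↭ {xs = x ∷ xs} (x∉ ∷ u) sub len with ∈-∃++ (sub (here refl))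
... | as , bs , refl = ↭-trans (↭-prep x (unique-⊆⇒↭ u sub′ len′)) (↭-sym (Perm.shift x as bs))
  where
  sub′ : ∀ {y} → y ∈ xs → y ∈ as ++ bs
  sub′ y∈ with ∈-++⁻ as (sub (there y∈))
  ... | inj₁ h = ∈-++⁺ˡ h
  ... | inj₂ (there h) = ∈-++⁺ʳ as h
  ... | inj₂ (here refl) = contradiction refl (All.lookup x∉ y∈)
  len′ : length (as ++ bs) ≤ length xs
  len′ = ≤-pred (≤-trans (≤-reflexive (sym (Perm.↭-length (Perm.shift x as bs)))) len)

length-range1 : ∀ n → length (range1 n) ≡ n
length-range1 n = trans (length-map suc (upTo n)) (length-upTo n)

countB-∈ : ∀ i σ {k} → countB (λ x → x ≡ᵇ i) σ ≡ suc k → i ∈ σ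
countB-∈ i (x ∷ σ) e with x ≡ᵇ i in x≡i
... | true  = here (sym (≡ᵇ⇒≡ x i (Equivalence.from T-≡ x≡i)))
... | false = there (countB-∈ i σ e)

∈-S⁻ : ∀ {n σ} → σ ∈ S n → σ ↭ range1 n
∈-S⁻ {n} {σ} σ∈ with Equivalence.to T-∧ (proj₂ (∈-filter⁻ (T? ∘ isPerm n) {xs = words n n} σ∈))
... | len , once = ↭-sym (unique-⊆⇒↭ (range1-unique n)
  (λ {i} i∈ → countB-∈ i σ (≡ᵇ⇒≡ _ 1 (All.lookup (All.all⁺ _ (range1 n) once) i∈)))
  (≤-reflexive (trans (≡ᵇ⇒≡ _ n len) (sym (length-range1 n)))))

∈-words : ∀ n k σ → length σ ≡ k → (∀ {x} → x ∈ σ → x ∈ range1 n) → σ ∈ words n k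
∈-words n zero [] _ _ = here refl
∈-words n (suc k) (x ∷ σ) len h = ∈-concatMap⁺ (λ w → map (_∷ w) (range1 n))
  (lose (∈-words n k σ (suc-injective len) (h ∘ there)) (∈-map⁺ (_∷ σ) (h (here refl))))

∈-S⁺ : ∀ {n σ} → σ ↭ range1 n → σ ∈ S n
∈-S⁺ {n} {σ} h = ∈-filter⁺ (T? ∘ isPerm n)
  (∈-words n n σ len (Perm.∈-resp-↭ h))
  (Equivalence.from T-∧ (≡⇒≡ᵇ _ n len , All.all⁻ _ (All.tabulate λ {i} i∈ → ≡⇒≡ᵇ _ 1 (once i i∈))))
  where
  len : length σ ≡ n
  len = trans (Perm.↭-length h) (length-range1 n)
  once : ∀ i → i ∈ range1 n → countB (λ x → x ≡ᵇ i) σ ≡ 1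
  once i i∈ = begin
    countB (λ x → x ≡ᵇ i) σ       ≡⟨ countB-∑ _ σ ⟩
    ∑ σ (λ x → 𝟙 (x ≡ᵇ i))        ≡⟨ ∑-cong σ (λ {x} _ → 𝟙-≡ x i) ⟩
    ∑ σ (λ x → eq x i)            ≡⟨ ∑-↭ _ h ⟩
    ∑ (range1 n) (λ x → eq x i)   ≡⟨ ∑-range1-eq n (proj₁ (∈-range1⁻ i∈)) (proj₂ (∈-range1⁻ i∈)) ⟩
    1 ∎
    where open ≡-Reasoning

words-unique : ∀ n k → Unique (words n k)
words-unique n zero = [] ∷ []
words-unique n (suc k) = Unique.concat⁺
  (All.map⁺ (All.tabulate λ {w} _ → Unique.map⁺ (λ { refl → refl }) (range1-unique n)))
  (AllPairs.map⁺ (AllPairs.map disjoint (words-unique n k)))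
  where
  disjoint : ∀ {w w′} → w ≢ w′ → ∀ {v} → ¬ (v ∈ map (_∷ w) (range1 n) × v ∈ map (_∷ w′) (range1 n))
  disjoint w≢w′ (h , h′) with ∈-map⁻ _ h | ∈-map⁻ _ h′
  ... | _ , _ , refl | _ , _ , refl = w≢w′ refl

S-unique : ∀ n → Unique (S n)
S-unique n = Unique.filter⁺ (T? ∘ isPerm n) (words-unique n n)

map-proj₁-zip : ∀ (xs : List A) (ys : List B) → length xs ≡ length ys → map proj₁ (zip xs ys) ≡ xs
map-proj₁-zip [] [] _ = refl
map-proj₁-zip (x ∷ xs) (y ∷ ys) e = cong (x ∷_) (map-proj₁-zip xs ys (suc-injective e))

map-proj₂-zip : ∀ (xs : List A) (ys : List B) → length xs ≡ length ys → map proj₂ (zip xs ys) ≡ ys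
map-proj₂-zip [] [] _ = refl
map-proj₂-zip (x ∷ xs) (y ∷ ys) e = cong (y ∷_) (map-proj₂-zip xs ys (suc-injective e))

zip-proj : ∀ (P : List (A × B)) → zip (map proj₁ P) (map proj₂ P) ≡ P
zip-proj [] = refl
zip-proj (x ∷ P) = cong (x ∷_) (zip-proj P)

graph-positions : ∀ σ → map proj₁ (graph σ) ≡ range1 (length σ)
graph-positions σ = map-proj₁-zip _ σ (length-range1 (length σ))

graph-values : ∀ σ → map proj₂ (graph σ) ≡ σ
graph-values σ = map-proj₂-zip _ σ (length-range1 (length σ))

S-length : ∀ {n σ} → σ ∈ S n → length σ ≡ n
S-length {n} σ∈ = trans (Perm.↭-length (∈-S⁻ {n} σ∈)) (length-range1 n)

graph-isPerm : ∀ {n σ} → σ ∈ S n → IsPerm n (graph σ)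
graph-isPerm {n} {σ} σ∈ = mkPerm (↭-reflexive (trans (graph-positions σ) (cong range1 (S-length {n} σ∈))))
                                 (↭-trans (↭-reflexive (graph-values σ)) (∈-S⁻ {n} σ∈))

-- Lifting the reordering of positions to the points sorts them by position; the values in that
-- order are the one-line notation.
isPerm-graph : ∀ {n P} → IsPerm n P → ∃[ σ ] σ ∈ S n × graph σ ↭ P
isPerm-graph {n} {P} (mkPerm ps vs) with Perm.↭-map-inv proj₁ ps
... | P′ , e , h = map proj₂ P′ , ∈-S⁺ {n} σ↭ , ↭-trans (↭-reflexive graph≡) (↭-sym h)
  where
  σ↭ : map proj₂ P′ ↭ range1 n
  σ↭ = ↭-trans (Perm.map⁺ proj₂ (↭-sym h)) vs
  graph≡ : graph (map proj₂ P′) ≡ P′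
  graph≡ = trans (cong (λ l → zip l (map proj₂ P′))
      (trans (cong range1 (trans (Perm.↭-length σ↭) (length-range1 n))) e)) (zip-proj P′)

↭⇒≡ : ∀ {P Q : List Point} → Unique (map proj₁ P) → map proj₁ P ≡ map proj₁ Q → P ↭ Q → P ≡ Q
↭⇒≡ {[]} {[]} _ _ _ = refl
↭⇒≡ {x ∷ P} {y ∷ Q} u e h with unique⇒injective proj₁ u (here refl) (Perm.∈-resp-↭ (↭-sym h) (here refl))
    (∷-injectiveˡ e)
↭⇒≡ {x ∷ P} {y ∷ Q} (_ ∷ u) e h | refl = cong (x ∷_) (↭⇒≡ u (∷-injectiveʳ e) (Perm.drop-∷ h))

graph-injective : ∀ {n σ τ} → σ ∈ S n → τ ∈ S n → graph σ ↭ graph τ → σ ≡ τ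
graph-injective {n} {σ} {τ} σ∈ τ∈ h = begin
  σ                    ≡⟨ graph-values σ ⟨
  map proj₂ (graph σ)  ≡⟨ cong (map proj₂)
      (↭⇒≡ (subst Unique (sym (graph-positions σ)) (range1-unique _)) positions h) ⟩
  map proj₂ (graph τ)  ≡⟨ graph-values τ ⟩
  τ                    ∎
  where
  open ≡-Reasoning
  positions = trans (graph-positions σ)
      (trans (cong range1 (trans (S-length {n} σ∈) (sym (S-length {n} τ∈)))) (sym (graph-positions τ)))

Sorted : List Point → Set
Sorted = AllPairs (_<_ on proj₁)

graph-sorted : ∀ σ → Sorted (graph σ)
graph-sorted σ = AllPairs.map⁻ (subst (AllPairs _<_) (sym (graph-positions σ))
  (AllPairs.map⁺ (AllPairs.applyUpTo⁺₁ id (length σ) λ i<j _ → s≤s i<j)))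

-- Statistics

-- The list order of a pair is its order of positions. Expressed by an indicator, it makes the sum
-- independent of the order of the list.
pairs-∑ : ∀ (f : Point × Point → Bool) {L} → Sorted L →
          countB f (pairs L) ≡ ∑∑ L (λ x y → lt (proj₁ x) (proj₁ y) * 𝟙 (f (x , y)))
pairs-∑ f [] = refl
pairs-∑ f {x ∷ L} (x< ∷ s) = begin
  countB f (map (x ,_) L ++ pairs L)
    ≡⟨ countB-++ f (map (x ,_) L) (pairs L) ⟩
  countB f (map (x ,_) L) + countB f (pairs L)
    ≡⟨ cong₂ _+_ (trans (countB-∑ f (map (x ,_) L)) (∑-map (x ,_) L _)) (pairs-∑ f s) ⟩
  ∑ L (λ y → 𝟙 (f (x , y))) + ∑∑ L K
    ≡⟨ cong₂ _+_ row (cong (_+ ∑∑ L K) (sym column)) ⟩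
  K x x + ∑ L (K x) + (∑ L (λ y → K y x) + ∑∑ L K)
    ≡⟨ ∑∑-∷ x L K ⟨
  ∑∑ (x ∷ L) K ∎
  where
  open ≡-Reasoning
  K : Point → Point → ℕ
  K x y = lt (proj₁ x) (proj₁ y) * 𝟙 (f (x , y))
  row : ∑ L (λ y → 𝟙 (f (x , y))) ≡ K x x + ∑ L (K x)
  row rewrite lt-no (≤-refl {proj₁ x}) = ∑-cong L λ {y} y∈ →
    sym (trans (cong (_* 𝟙 (f (x , y))) (lt-yes (All.lookup x< y∈))) (+-identityʳ _))
  column : ∑ L (λ y → K y x) ≡ 0
  column = ∑-0 L λ {y} y∈ → cong (_* 𝟙 (f (y , x))) (lt-no (<⇒≤ (All.lookup x< y∈)))

invK nesK : Point → Point → ℕ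
invK (i , a) (j , b) = lt i j * lt b a
nesK (i , a) (j , b) = lt i j * (lt b a * (lt j b + le a i))

invₚ nesₚ : List Point → ℕ
invₚ P = ∑∑ P invK
nesₚ P = ∑∑ P nesK

fp-graph : ∀ σ → fp σ ≡ fpₚ (graph σ)
fp-graph σ = trans (countB-∑ _ (graph σ)) (∑-cong (graph σ) λ { {i , a} _ → 𝟙-≡ i a })

exc-graph : ∀ σ → exc σ ≡ excₚ (graph σ)
exc-graph σ = trans (countB-∑ _ (graph σ)) (∑-cong (graph σ) λ { {i , a} _ → 𝟙-< i a })

inv-graph : ∀ σ → inv σ ≡ invₚ (graph σ)
inv-graph σ = trans (pairs-∑ _ (graph-sorted σ))
  (∑∑-cong (graph σ) λ { {i , a} {j , b} _ _ → cong (lt i j *_) (𝟙-< b a) })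

crs-graph : ∀ σ → crs σ ≡ crsₚ (graph σ)
crs-graph σ = trans (pairs-∑ _ (graph-sorted σ)) (∑∑-cong (graph σ) λ {x} {y} _ _ → point x y)
  where
  point : ∀ x y → lt (proj₁ x) (proj₁ y) * 𝟙
      (((proj₁ y <ᵇ proj₂ x) ∧ (proj₂ x <ᵇ proj₂ y)) ∨ ((proj₂ x <ᵇ proj₂ y) ∧ (proj₂ y ≤ᵇ proj₁ x)))
              ≡ crsK x y
  point (i , a) (j , b) with i <? j
  ... | no i≮j rewrite lt-no (≮⇒≥ i≮j) = refl
  ... | yes i<j rewrite 𝟙-∨ ((j <ᵇ a) ∧ (a <ᵇ b)) ((a <ᵇ b) ∧ (b ≤ᵇ i))
                  (λ u v → let j<a , a<b = Equivalence.to T-∧ u ; _ , b≤i = Equivalence.to T-∧ v in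
                    <-irrefl refl (<-trans i<j
                        (<-≤-trans (<-trans (<ᵇ⇒< j a j<a) (<ᵇ⇒< a b a<b)) (≤ᵇ⇒≤ b i b≤i))))
              | 𝟙-∧ (j <ᵇ a) (a <ᵇ b) | 𝟙-∧ (a <ᵇ b) (b ≤ᵇ i) | 𝟙-< j a | 𝟙-< a b | 𝟙-≤ b i =
    solve 4 (λ l x y z → l :* (y :* x :+ x :* z) := l :* (x :* (y :+ z))) refl (lt i j) (lt a b) (lt j a)
        (le b i)
    where open +-*-Solver

nes-graph : ∀ σ → nes σ ≡ nesₚ (graph σ)
nes-graph σ = trans (pairs-∑ _ (graph-sorted σ)) (∑∑-cong (graph σ) λ {x} {y} _ _ → point x y)
  where
  point : ∀ x y → lt (proj₁ x) (proj₁ y) * 𝟙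
      (((proj₁ y <ᵇ proj₂ y) ∧ (proj₂ y <ᵇ proj₂ x)) ∨ ((proj₂ y <ᵇ proj₂ x) ∧ (proj₂ x ≤ᵇ proj₁ x)))
              ≡ nesK x y
  point (i , a) (j , b) with i <? j
  ... | no i≮j rewrite lt-no (≮⇒≥ i≮j) = refl
  ... | yes i<j rewrite 𝟙-∨ ((j <ᵇ b) ∧ (b <ᵇ a)) ((b <ᵇ a) ∧ (a ≤ᵇ i))
                  (λ u v → let j<b , b<a = Equivalence.to T-∧ u ; _ , a≤i = Equivalence.to T-∧ v in
                    <-irrefl refl (<-trans i<j
                        (<-≤-trans (<-trans (<ᵇ⇒< j b j<b) (<ᵇ⇒< b a b<a)) (≤ᵇ⇒≤ a i a≤i))))
              | 𝟙-∧ (j <ᵇ b) (b <ᵇ a) | 𝟙-∧ (b <ᵇ a) (a ≤ᵇ i) | 𝟙-< j b | 𝟙-< b a | 𝟙-≤ a i =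
    solve 4 (λ l x y z → l :* (y :* x :+ x :* z) := l :* (x :* (y :+ z))) refl (lt i j) (lt b a) (lt j b)
        (le a i)
    where open +-*-Solver

-- Patterns

subseqs-map : ∀ (f : A → B) k xs → subseqs k (map f xs) ≡ map (map f) (subseqs k xs)
subseqs-map f zero xs = refl
subseqs-map f (suc k) [] = refl
subseqs-map f (suc k) (x ∷ xs) rewrite subseqs-map f k xs | subseqs-map f (suc k) xs
  | map-++ (map f) (map (x ∷_) (subseqs k xs)) (subseqs (suc k) xs) =
  cong (_++ map (map f) (subseqs (suc k) xs)) (trans (sym (map-∘ (subseqs k xs))) (map-∘ (subseqs k xs)))

∈-subseqs⁻ : ∀ k {L Q} → Sorted L → Q ∈ subseqs k L → Sorted Q × All (_∈ L) Q × length Q ≡ k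
∈-subseqs⁻ zero _ (here refl) = [] , [] , refl
∈-subseqs⁻ (suc k) {x ∷ L} (x< ∷ s) Q∈ with ∈-++⁻ (map (x ∷_) (subseqs k L)) Q∈
... | inj₂ h with ∈-subseqs⁻ (suc k) s h
...   | u , v , e = u , All.map there v , e
∈-subseqs⁻ (suc k) {x ∷ L} (x< ∷ s) Q∈ | inj₁ h with ∈-map⁻ (x ∷_) h
... | Q , Q∈′ , refl with ∈-subseqs⁻ k s Q∈′
...   | u , v , e = All.map (All.lookup x<) v ∷ u , here refl ∷ All.map there v , cong suc e

∈-subseqs⁺ : ∀ {L Q} → Sorted L → Sorted Q → All (_∈ L) Q → Q ∈ subseqs (length Q) L
∈-subseqs⁺ _ [] [] = here refl
∈-subseqs⁺ {y ∷ L} {x ∷ Q} (y< ∷ s) (x< ∷ u) (here refl ∷ v) =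
  ∈-++⁺ˡ (∈-map⁺ (x ∷_) (∈-subseqs⁺ s u (All.tabulate λ z∈ → later (All.lookup v z∈) (All.lookup x< z∈))))
  where
  later : ∀ {z} → z ∈ x ∷ L → proj₁ x < proj₁ z → z ∈ L
  later (here refl) h = contradiction h (<-irrefl refl)
  later (there z∈) _ = z∈
∈-subseqs⁺ {y ∷ L} {x ∷ Q} (y< ∷ s) (x< ∷ u) (there x∈ ∷ v) =
  ∈-++⁺ʳ (map (y ∷_) (subseqs (length Q) L)) (∈-subseqs⁺ s (x< ∷ u)
    (x∈ ∷ All.tabulate λ z∈ → later (All.lookup v z∈) (<-trans (All.lookup y< x∈) (All.lookup x< z∈))))
  where
  later : ∀ {z} → z ∈ y ∷ L → proj₁ y < proj₁ z → z ∈ L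
  later (here refl) h = contradiction h (<-irrefl refl)
  later (there z∈) _ = z∈

Cmp⇒T : ∀ t u {a b} → Cmp t u a b → T ((a <ᵇ b) ==ᴮ (t <ᵇ u))
Cmp⇒T t u {a} {b} h with t <ᵇ u | a <ᵇ b in e
... | true  | true  = _
... | true  | false = subst T e (<⇒<ᵇ h)
... | false | false = _
... | false | true  = <-asym h (<ᵇ⇒< a b (Equivalence.from T-≡ e))

-- Equal entries would pass the Boolean test as a descent, hence the hypothesis of distinctness.
T⇒Cmp : ∀ t u {a b} → a ≢ b → T ((a <ᵇ b) ==ᴮ (t <ᵇ u)) → Cmp t u a b
T⇒Cmp t u {a} {b} a≢b h with t <ᵇ u | a <ᵇ b in e
... | true  | true  = <ᵇ⇒< a b (Equivalence.from T-≡ e)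
... | false | false = ≤∧≢⇒< (≮⇒≥ λ a<b → subst T e (<⇒<ᵇ a<b)) (a≢b ∘ sym)

module _ {n σ} (σ∈ : σ ∈ S n) (t u v : ℕ) where
  private
    L : List Point
    L = graph σ
    τ : List ℕ
    τ = t ∷ u ∷ v ∷ []
    -- Passing to subsequences of the graph recovers the positions, which one-line notation hides.
    contains≡ : contains τ σ ≡ any (λ s → orderIso s τ) (map (map proj₂) (subseqs 3 L))
    contains≡ = cong (any (λ s → orderIso s τ))
      (trans (cong (subseqs 3) (sym (graph-values σ))) (subseqs-map proj₂ 3 L))

  contains⇒pattern : T (contains τ σ) → HasPattern t u v L
  contains⇒pattern h with find (Any.map⁻
      (Any.any⁻ (λ s → orderIso s τ) (map (map proj₂) (subseqs 3 L)) (subst T contains≡ h)))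
  ... | Q , Q∈ , iso with Q | ∈-subseqs⁻ 3 (graph-sorted σ) Q∈
  ...   | x ∷ y ∷ z ∷ [] | ((x<y ∷ x<z ∷ []) ∷ (y<z ∷ []) ∷ _) , (x∈ ∷ y∈ ∷ z∈ ∷ []) , _ =
    let p , qr = Equivalence.to (T-∧ {(proj₂ x <ᵇ proj₂ y) ==ᴮ (t <ᵇ u)}) iso
        q , r0 = Equivalence.to (T-∧ {(proj₂ x <ᵇ proj₂ z) ==ᴮ (t <ᵇ v)}) qr
        r , _ = Equivalence.to (T-∧ {(proj₂ y <ᵇ proj₂ z) ==ᴮ (u <ᵇ v)}) r0
    in occurs x∈ y∈ z∈ x<y y<z (T⇒Cmp t u (distinct x∈ y∈ x<y) p) (T⇒Cmp t v (distinct x∈ z∈ x<z) q)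
         (T⇒Cmp u v (distinct y∈ z∈ y<z) r)
    where
    distinct : ∀ {x y} → x ∈ L → y ∈ L → proj₁ x < proj₁ y → proj₂ x ≢ proj₂ y
    distinct x∈ y∈ x<y e = <⇒≢ x<y (cong proj₁ (value-injective (graph-isPerm {n} σ∈) x∈ y∈ e))

  pattern⇒contains : HasPattern t u v L → T (contains τ σ)
  pattern⇒contains (occurs x∈ y∈ z∈ i<j j<k ab ac bc) = subst T (sym contains≡) (Any.any⁺ _ (lose
    (∈-map⁺ (map proj₂) (∈-subseqs⁺ (graph-sorted σ) ((i<j ∷ <-trans i<j j<k ∷ []) ∷ (j<k ∷ []) ∷ [] ∷ [])
        (x∈ ∷ y∈ ∷ z∈ ∷ [])))
    (Equivalence.from T-∧ (Cmp⇒T t u ab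
        , Equivalence.from T-∧ (Cmp⇒T t v ac , Equivalence.from T-∧ (Cmp⇒T u v bc , _))))))

  avoids⇒¬pattern : T (avoids τ σ) → ¬ HasPattern t u v L
  avoids⇒¬pattern h p with contains τ σ | pattern⇒contains p
  ... | true | _ = h

  ¬pattern⇒avoids : ¬ HasPattern t u v L → T (avoids τ σ)
  ¬pattern⇒avoids h with contains τ σ | contains⇒pattern
  ... | true  | p = contradiction (p _) h
  ... | false | _ = _

-- Distributions over the avoidance classes

module _ (C : Class) (t u v : ℕ) where
  open Class C using (Avoid)
  open Generate C

  tree-count : (∀ {P} → Avoid P → ¬ HasPattern t u v P) → (∀ {P} → ¬ HasPattern t u v P → Avoid P) →
    ∀ n w → countB (λ σ → avoids (t ∷ u ∷ v ∷ []) σ ∧ (stats (fp ∷ exc ∷ crs ∷ []) σ ==ᴸ w)) (S n)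
          ≡ countB (λ l → (Label.fixed l ∷ Label.excedances l ∷ Label.crossings l ∷ []) ==ᴸ w) (Tree n)
  tree-count sound complete n w = begin
    countB p (S n)         ≡⟨ ≤-antisym S≤Gen Gen≤S ⟩
    countB (q ∘ lab) (Gen n) ≡⟨ countB-map q lab (Gen n) ⟨
    countB q (map lab (Gen n)) ≡⟨ cong (countB q) (labels n) ⟩
    countB q (Tree n)      ∎
    where
    open ≡-Reasoning
    p : List ℕ → Bool
    p σ = avoids (t ∷ u ∷ v ∷ []) σ ∧ (stats (fp ∷ exc ∷ crs ∷ []) σ ==ᴸ w)
    q : Label → Bool
    q l = (Label.fixed l ∷ Label.excedances l ∷ Label.crossings l ∷ []) ==ᴸ w
    same : ∀ {σ st} → Inv n st → points st ↭ graph σ →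
           stats (fp ∷ exc ∷ crs ∷ []) σ
               ≡ Label.fixed (lab st) ∷ Label.excedances (lab st) ∷ Label.crossings (lab st) ∷ []
    same {σ} I h = cong₂ _∷_ (trans (fp-graph σ) (trans (∑-↭ _ (↭-sym h)) (Inv.fp-≡ I)))
      (cong₂ _∷_ (trans (exc-graph σ) (trans (∑-↭ _ (↭-sym h)) (Inv.exc-≡ I)))
      (cong (_∷ []) (trans (crs-graph σ) (trans (∑∑-↭ crsK (↭-sym h)) (Inv.crs-≡ I)))))
    S≤Gen : countB p (S n) ≤ countB (q ∘ lab) (Gen n)
    S≤Gen = countB-≤ {R = λ σ st → points st ↭ graph σ} (S-unique n) total
      λ σ∈ σ′∈ h h′ σ≢σ′ → σ≢σ′ (graph-injective {n} σ∈ σ′∈ (↭-trans (↭-sym h) h′))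
      where
      total : ∀ {σ} → σ ∈ S n → T (p σ) → ∃[ st ] st ∈ Gen n × T (q (lab st)) × points st ↭ graph σ
      total {σ} σ∈ pσ with Equivalence.to (T-∧ {avoids (t ∷ u ∷ v ∷ []) σ}) pσ
      ... | av , e with gen-complete n (graph-isPerm {n} σ∈) (complete (avoids⇒¬pattern {n} σ∈ t u v av))
      ...   | st , st∈ , h = st , st∈ , subst (λ l → T (l ==ᴸ w)) (same (gen-inv n st∈) h) e , h
    Gen≤S : countB (q ∘ lab) (Gen n) ≤ countB p (S n)
    Gen≤S = countB-≤ {R = λ st σ → points st ↭ graph σ} (gen-distinct n) total
      λ _ _ h h′ apart → apart (↭-trans h (↭-sym h′))
      where
      total : ∀ {st} → st ∈ Gen n → T (q (lab st)) → ∃[ σ ] σ ∈ S n × T (p σ) × points st ↭ graph σ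
      total {st} st∈ qst with isPerm-graph (Inv.perm (gen-inv n st∈))
      ... | σ , σ∈ , h = σ , σ∈ , Equivalence.from T-∧
            ( ¬pattern⇒avoids {n} σ∈ t u v (sound (Inv.avoid (gen-inv n st∈)) ∘ pattern-resp-↭ h)
            , subst (λ l → T (l ==ᴸ w)) (sym (same (gen-inv n st∈) (↭-sym h))) qst) , ↭-sym h

wilf-132-321 : WilfEq (fp ∷ exc ∷ crs ∷ []) (1 ∷ 3 ∷ 2 ∷ []) (3 ∷ 2 ∷ 1 ∷ [])
wilf-132-321 n w = trans (tree-count Class₁₃₂.class 1 3 2 id id n w)
    (sym (tree-count Class₃₂₁.class 3 2 1 id id n w))

-- Symmetries

module Symmetry (φ : ℕ → Point → Point)
  (φ-isPerm : ∀ {n P} → IsPerm n P → IsPerm n (map (φ n) P))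
  (φ-involutive : ∀ {n P x} → IsPerm n P → x ∈ P → φ n (φ n x) ≡ x) where

  map-involutive : ∀ {n P} → IsPerm n P → map (φ n) (map (φ n) P) ≡ P
  map-involutive {n} {P} perm = trans (sym (map-∘ P)) (map-id-local (All.tabulate (φ-involutive perm)))

  module _ {t u v t′ u′ v′ : ℕ} {sts : List Stat}
    (pattern⁻ : ∀ {n P} → IsPerm n P → HasPattern t′ u′ v′ (map (φ n) P) → HasPattern t u v P)
    (invariant : ∀ {n σ σ′} → σ ∈ S n → graph σ′ ↭ map (φ n) (graph σ) → stats sts σ ≡ stats sts σ′)
    where

    -- The involution induces an injection of one avoidance class into the other that keeps the
    -- statistics; exchanging the patterns gives the reverse inequality.
    count-≤ : ∀ n w → countB (λ σ → avoids (t ∷ u ∷ v ∷ []) σ ∧ (stats sts σ ==ᴸ w)) (S n)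
                    ≤ countB (λ σ → avoids (t′ ∷ u′ ∷ v′ ∷ []) σ ∧ (stats sts σ ==ᴸ w)) (S n)
    count-≤ n w = countB-≤ {R = λ σ σ′ → graph σ′ ↭ map (φ n) (graph σ)} (S-unique n) total separate
      where
      total : ∀ {σ} → σ ∈ S n → T (avoids (t ∷ u ∷ v ∷ []) σ ∧ (stats sts σ ==ᴸ w)) →
              ∃[ σ′ ] σ′ ∈ S n × T (avoids (t′ ∷ u′ ∷ v′ ∷ []) σ′ ∧ (stats sts σ′ ==ᴸ w))
                  × graph σ′ ↭ map (φ n) (graph σ)
      total {σ} σ∈ h with Equivalence.to (T-∧ {avoids (t ∷ u ∷ v ∷ []) σ}) h
          | isPerm-graph (φ-isPerm (graph-isPerm {n} σ∈))
      ... | av , e | σ′ , σ′∈ , g = σ′ , σ′∈ , Equivalence.from T-∧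
        ( ¬pattern⇒avoids {n} σ′∈ t′ u′ v′
            (avoids⇒¬pattern {n} σ∈ t u v av ∘ pattern⁻ (graph-isPerm {n} σ∈) ∘ pattern-resp-↭ g)
        , subst (λ l → T (l ==ᴸ w)) (invariant {n} σ∈ g) e ) , g
      separate : ∀ {σ σ′ τ} → σ ∈ S n → σ′ ∈ S n → graph τ ↭ map (φ n) (graph σ) →
          graph τ ↭ map (φ n) (graph σ′) → ¬ σ ≢ σ′
      separate {σ} {σ′} σ∈ σ′∈ g g′ σ≢σ′ = σ≢σ′ (graph-injective {n} σ∈ σ′∈ (begin
        graph σ                          ≡⟨ map-involutive (graph-isPerm {n} σ∈) ⟨
        map (φ n) (map (φ n) (graph σ))  ↭⟨ Perm.map⁺ (φ n) (↭-trans (↭-sym g) g′) ⟩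
        map (φ n) (map (φ n) (graph σ′)) ≡⟨ map-involutive (graph-isPerm {n} σ′∈) ⟩
        graph σ′                         ∎))
        where open PermutationReasoning

∸-cancel-< : ∀ N {a b} → N ∸ a < N ∸ b → b < a
∸-cancel-< N {a} {b} h = ≰⇒> λ a≤b → <⇒≱ h (∸-monoʳ-≤ N a≤b)

lt-∸ : ∀ {N a b} → a ≤ N → b ≤ N → lt (N ∸ a) (N ∸ b) ≡ lt b a
lt-∸ {N} a≤N _ = lt-⇔ (∸-cancel-< N) λ b<a → ∸-monoʳ-< b<a a≤N

le-∸ : ∀ {N a b} → a ≤ N → b ≤ N → le (N ∸ a) (N ∸ b) ≡ le b a
le-∸ {N} {a} {b} a≤N b≤N = +-cancelʳ-≡ (lt a b) _ _ (begin
  le (N ∸ a) (N ∸ b) + lt a b             ≡⟨ cong (le (N ∸ a) (N ∸ b) +_) (lt-∸ b≤N a≤N) ⟨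
  le (N ∸ a) (N ∸ b) + lt (N ∸ b) (N ∸ a) ≡⟨ le+lt (N ∸ a) (N ∸ b) ⟩
  1                                       ≡⟨ le+lt b a ⟨
  le b a + lt a b                         ∎)
  where open ≡-Reasoning

-- Reflection in the antidiagonal: complementing restores the order that swapping the coordinates
-- reverses, so i < a is preserved.
rci : ℕ → Point → Point
rci n (i , a) = suc n ∸ a , suc n ∸ i

range1-reverse : ∀ n → map (suc n ∸_) (range1 n) ↭ range1 n
range1-reverse n = ↭-sym (unique-⊆⇒↭ (range1-unique n) reflect
  (≤-reflexive (length-map (suc n ∸_) (range1 n))))
  where
  reflect : ∀ {i} → i ∈ range1 n → i ∈ map (suc n ∸_) (range1 n)
  reflect {i} i∈ with ∈-range1⁻ i∈
  ... | s≤s {n = i₀} z≤n , i≤n = subst (_∈ map (suc n ∸_) (range1 n)) (m∸[m∸n]≡n (m≤n⇒m≤1+n i≤n))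
          (∈-map⁺ (suc n ∸_) (∈-range1⁺ (m<n⇒0<n∸m i≤n) (m∸n≤m n i₀)))

rci-isPerm : ∀ {n P} → IsPerm n P → IsPerm n (map (rci n) P)
rci-isPerm {n} {P} (mkPerm ps vs) = mkPerm
  (↭-trans (↭-reflexive (trans (sym (map-∘ P)) (map-∘ P)))
      (↭-trans (Perm.map⁺ (suc n ∸_) vs) (range1-reverse n)))
  (↭-trans (↭-reflexive (trans (sym (map-∘ P)) (map-∘ P)))
      (↭-trans (Perm.map⁺ (suc n ∸_) ps) (range1-reverse n)))

module _ {n P} (perm : IsPerm n P) where
  position-≤ : ∀ {x} → x ∈ P → proj₁ x ≤ suc n
  position-≤ x∈ = m≤n⇒m≤1+n (proj₂ (position-∈ perm x∈))

  value-≤ : ∀ {x} → x ∈ P → proj₂ x ≤ suc n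
  value-≤ x∈ = m≤n⇒m≤1+n (proj₂ (value-∈ perm x∈))

  rci-involutive : ∀ {x} → x ∈ P → rci n (rci n x) ≡ x
  rci-involutive x∈ = cong₂ _,_ (m∸[m∸n]≡n (position-≤ x∈)) (m∸[m∸n]≡n (value-≤ x∈))

  fp-rci : fpₚ (map (rci n) P) ≡ fpₚ P
  fp-rci = trans (∑-map (rci n) P fpK) (∑-cong P (λ {x} → point {x}))
    where
    point : ∀ {x} → x ∈ P → fpK (rci n x) ≡ fpK x
    point {i , a} x∈ with i ≟ a
    ... | yes refl = trans (eq-yes {suc n ∸ i} refl) (sym (eq-yes {i} refl))
    ... | no i≢a = trans (eq-no λ e → i≢a (sym (∸-cancelˡ-≡ (value-≤ x∈) (position-≤ x∈) e)))
        (sym (eq-no i≢a))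

  exc-rci : excₚ (map (rci n) P) ≡ excₚ P
  exc-rci = trans (∑-map (rci n) P excK) (∑-cong P λ x∈ → lt-∸ (value-≤ x∈) (position-≤ x∈))

  inv-rci : invₚ (map (rci n) P) ≡ invₚ P
  inv-rci = trans (∑∑-map (rci n) P invK) (∑∑-cong P λ {x} {y} → point {x} {y})
    where
    point : ∀ {x y} → x ∈ P → y ∈ P → invK (rci n x) (rci n y) ≡ invK x y
    point {i , a} {j , b} x∈ y∈ rewrite lt-∸ (value-≤ x∈) (value-≤ y∈)
        | lt-∸ (position-≤ y∈) (position-≤ x∈) = *-comm (lt b a) (lt i j)

  -- The two points of a crossing ascend, and the reflection exchanges their order, hence the flip.
  -- Points that descend, as in inversions and nestings, keep theirs.
  crs-rci : crsₚ (map (rci n) P) ≡ crsₚ P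
  crs-rci = trans (∑∑-map (rci n) P crsK) (trans (∑∑-cong P λ {y} {x} → point {y} {x}) (∑∑-flip P crsK))
    where
    point : ∀ {y x} → y ∈ P → x ∈ P → crsK (rci n y) (rci n x) ≡ crsK x y
    point {j , b} {i , a} y∈ x∈
      rewrite lt-∸ (value-≤ y∈) (value-≤ x∈) | lt-∸ (position-≤ y∈) (position-≤ x∈)
            | lt-∸ (value-≤ x∈) (position-≤ y∈) | le-∸ (position-≤ x∈) (value-≤ y∈) =
      solve 3 (λ u v w → u :* (v :* w) := v :* (u :* w)) refl (lt a b) (lt i j) (lt j a + le b i)
      where open +-*-Solver

  nes-rci : nesₚ (map (rci n) P) ≡ nesₚ P
  nes-rci = trans (∑∑-map (rci n) P nesK) (∑∑-cong P λ {x} {y} → point {x} {y})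
    where
    point : ∀ {x y} → x ∈ P → y ∈ P → nesK (rci n x) (rci n y) ≡ nesK x y
    point {i , a} {j , b} x∈ y∈
      rewrite lt-∸ (value-≤ x∈) (value-≤ y∈) | lt-∸ (position-≤ y∈) (position-≤ x∈)
            | lt-∸ (value-≤ y∈) (position-≤ y∈) | le-∸ (position-≤ x∈) (value-≤ x∈) =
      solve 3 (λ u v w → u :* (v :* w) := v :* (u :* w)) refl (lt b a) (lt i j) (lt j b + le a i)
      where open +-*-Solver

module _ {n : ℕ} {P : List Point} where
  rci-213⁻ : HasPattern 2 1 3 (map (rci n) P) → HasPattern 1 3 2 P
  rci-213⁻ (occurs x∈ y∈ z∈ i<j j<k b<a a<c b<c) with ∈-map⁻ (rci n) x∈ | ∈-map⁻ (rci n) y∈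
      | ∈-map⁻ (rci n) z∈
  ... | _ , x , refl | _ , y , refl | _ , z , refl = occurs z x y (∸-cancel-< N a<c) (∸-cancel-< N b<a)
      (∸-cancel-< N (<-trans i<j j<k)) (∸-cancel-< N j<k) (∸-cancel-< N i<j)
    where N = suc n

  rci-132⁻ : HasPattern 1 3 2 (map (rci n) P) → HasPattern 2 1 3 P
  rci-132⁻ (occurs x∈ y∈ z∈ i<j j<k a<b a<c c<b) with ∈-map⁻ (rci n) x∈ | ∈-map⁻ (rci n) y∈
      | ∈-map⁻ (rci n) z∈
  ... | _ , x , refl | _ , y , refl | _ , z , refl = occurs y z x (∸-cancel-< N c<b) (∸-cancel-< N a<c)
      (∸-cancel-< N j<k) (∸-cancel-< N i<j) (∸-cancel-< N (<-trans i<j j<k))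
    where N = suc n

inverse : ℕ → Point → Point
inverse _ (i , a) = a , i

module _ {n : ℕ} {P : List Point} where
  inverse-312⁻ : HasPattern 3 1 2 (map (inverse n) P) → HasPattern 2 3 1 P
  inverse-312⁻ (occurs x∈ y∈ z∈ i<j j<k b<a c<a b<c) with ∈-map⁻ (inverse n) x∈ | ∈-map⁻ (inverse n) y∈
      | ∈-map⁻ (inverse n) z∈
  ... | _ , x , refl | _ , y , refl | _ , z , refl = occurs y z x b<c c<a j<k i<j (<-trans i<j j<k)

  inverse-231⁻ : HasPattern 2 3 1 (map (inverse n) P) → HasPattern 3 1 2 P
  inverse-231⁻ (occurs x∈ y∈ z∈ i<j j<k a<b c<a c<b) with ∈-map⁻ (inverse n) x∈ | ∈-map⁻ (inverse n) y∈
      | ∈-map⁻ (inverse n) z∈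
  ... | _ , x , refl | _ , y , refl | _ , z , refl = occurs z x y c<a a<b (<-trans i<j j<k) j<k i<j

inverse-isPerm : ∀ {n P} → IsPerm n P → IsPerm n (map (inverse n) P)
inverse-isPerm {P = P} (mkPerm ps vs) =
    mkPerm (↭-trans (↭-reflexive (sym (map-∘ P))) vs) (↭-trans (↭-reflexive (sym (map-∘ P))) ps)

module _ {n P} (perm : IsPerm n P) where

  fp-inverse : fpₚ (map (inverse n) P) ≡ fpₚ P
  fp-inverse = trans (∑-map (inverse n) P fpK) (∑-cong P λ { {i , a} _ → eq-sym a i })

  inv-inverse : invₚ (map (inverse n) P) ≡ invₚ P
  inv-inverse = trans (∑∑-map (inverse n) P invK) (trans
    (∑∑-cong P λ { {j , b} {i , a} _ _ → *-comm (lt b a) (lt i j) }) (∑∑-flip P invK))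

  -- As many positions as values exceed m. The points right of and above (m , m) are common to both
  -- counts, and no other point shares a coordinate with the fixed point.
  fixed-balance : ∀ {m} → (m , m) ∈ P →
      ∑ P (λ { (j , b) → lt m j * lt b m }) ≡ ∑ P (λ { (i , a) → lt i m * lt m a })
  fixed-balance {m} m∈ = +-cancelʳ-≡ (∑ P (λ { (j , b) → lt m j * lt m b })) _ _ (begin
    ∑ P (λ { (j , b) → lt m j * lt b m }) + ∑ P (λ { (j , b) → lt m j * lt m b })
      ≡⟨ ∑-+ P _ _ ⟨
    ∑ P (λ { (j , b) → lt m j * lt b m + lt m j * lt m b })
      ≡⟨ ∑-cong P (λ {x} → right-of {x}) ⟩
    ∑ P (λ x → lt m (proj₁ x))
      ≡⟨ ∑-positions perm (lt m) ⟩
    ∑ (range1 n) (lt m)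
      ≡⟨ ∑-values perm (lt m) ⟨
    ∑ P (λ x → lt m (proj₂ x))
      ≡⟨ ∑-cong P (λ {x} → above {x}) ⟨
    ∑ P (λ { (i , a) → lt i m * lt m a + lt m i * lt m a })
      ≡⟨ ∑-+ P _ _ ⟩
    ∑ P (λ { (i , a) → lt i m * lt m a }) + ∑ P (λ { (j , b) → lt m j * lt m b }) ∎)
    where
    open ≡-Reasoning
    right-of : ∀ {x} → x ∈ P → lt m (proj₁ x) * lt (proj₂ x) m + lt m (proj₁ x) * lt m (proj₂ x)
        ≡ lt m (proj₁ x)
    right-of {j , b} x∈ with <-cmp b m
    ... | tri< h _ _ rewrite lt-yes h | lt-no (<⇒≤ h) | *-zeroʳ (lt m j) =
        trans (+-identityʳ _) (*-identityʳ _)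
    ... | tri> _ _ h rewrite lt-yes h | lt-no (<⇒≤ h) | *-zeroʳ (lt m j) = *-identityʳ _
    ... | tri≈ _ refl _ with value-injective perm x∈ m∈ refl
    ...   | refl rewrite lt-no (≤-refl {m}) = refl
    above : ∀ {x} → x ∈ P → lt (proj₁ x) m * lt m (proj₂ x) + lt m (proj₁ x) * lt m (proj₂ x) ≡ lt m (proj₂ x)
    above {j , b} x∈ with <-cmp j m
    ... | tri< h _ _ rewrite lt-yes h | lt-no (<⇒≤ h) = trans (+-identityʳ _) (+-identityʳ _)
    ... | tri> _ _ h rewrite lt-yes h | lt-no (<⇒≤ h) = +-identityʳ _
    ... | tri≈ _ refl _ with position-injective perm x∈ m∈ refl
    ...   | refl rewrite lt-no (≤-refl {m}) = refl

  -- Inverses exchange upper and lower nestings, except that only lower ones may involve a fixed point.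
  nes-inverse : nesₚ (map (inverse n) P) ≡ nesₚ P
  nes-inverse = +-cancelʳ-≡ (∑∑ P below) _ _ (begin
    nesₚ (map (inverse n) P) + ∑∑ P below
      ≡⟨ cong (_+ ∑∑ P below) (trans (∑∑-map (inverse n) P nesK)
          (sym (∑∑-flip P (λ y x → nesK (inverse n y) (inverse n x))))) ⟩
    ∑∑ P (λ x y → nesK (inverse n y) (inverse n x)) + ∑∑ P below
      ≡⟨ ∑∑-+ P _ below ⟨
    ∑∑ P (λ x y → nesK (inverse n y) (inverse n x) + below x y)
      ≡⟨ ∑∑-cong P (λ {x} {y} _ _ → point x y) ⟩
    ∑∑ P (λ x y → nesK x y + above x y)
      ≡⟨ ∑∑-+ P nesK above ⟩
    nesₚ P + ∑∑ P above
      ≡⟨ cong (nesₚ P +_) above≡below ⟩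
    nesₚ P + ∑∑ P below ∎)
    where
    open ≡-Reasoning
    -- `below` is the part of `nesK` with a fixed inner point; `above` is its mirror image, which
    -- `nesK` leaves out.
    below above : Point → Point → ℕ
    below (i , a) (j , b) = eq i a * (lt i j * lt b i)
    above (i , a) (j , b) = eq j b * (lt i j * lt j a)
    le≡ : ∀ m n → le m n ≡ lt m n + eq m n
    le≡ m n with <-cmp m n
    ... | tri< h k _ rewrite le-yes (<⇒≤ h) | lt-yes h | eq-no k = refl
    ... | tri≈ _ refl _ rewrite le-yes (≤-refl {m}) | lt-no (≤-refl {m}) | eq-yes {m} refl = refl
    ... | tri> _ k h rewrite le-no h | lt-no (<⇒≤ h) | eq-no k = refl
    below≡ : ∀ i a j b → eq i a * (lt i j * lt b i) ≡ eq i a * (lt i j * lt b a)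
    below≡ i a j b with i ≟ a
    ... | yes refl = refl
    ... | no h rewrite eq-no h = refl
    above≡ : ∀ i a j b → eq j b * (lt i j * lt j a) ≡ eq j b * (lt i j * lt b a)
    above≡ i a j b with j ≟ b
    ... | yes refl = refl
    ... | no h rewrite eq-no h = refl
    point : ∀ x y → nesK (inverse n y) (inverse n x) + below x y ≡ nesK x y + above x y
    point (i , a) (j , b)
      rewrite below≡ i a j b | above≡ i a j b | le≡ j b | le≡ a i | eq-sym i a =
      solve 6 (λ u v w x y z → u :* (v :* (w :+ (x :+ y))) :+ z :* (v :* u)
                            := v :* (u :* (x :+ (w :+ z))) :+ y :* (v :* u))
        refl (lt b a) (lt i j) (lt a i) (lt j b) (eq j b) (eq a i)
      where open +-*-Solver
    above≡below : ∑∑ P above ≡ ∑∑ P below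
    above≡below = trans (sym (∑∑-flip P above)) (∑-cong P λ {x} → row {x})
      where
      row : ∀ {x} → x ∈ P → ∑ P (λ y → above y x) ≡ ∑ P (below x)
      row {i , a} x∈ with i ≟ a
      ... | no h = trans (∑-0 P λ { {j , b} _ → cong (_* (lt j i * lt i b)) (eq-no h) })
                     (sym (∑-0 P λ { {j , b} _ → cong (_* (lt i j * lt b i)) (eq-no h) }))
      ... | yes refl = trans (∑-*ˡ P (eq i i) _)
          (trans (cong (eq i i *_) (sym (fixed-balance x∈))) (sym (∑-*ˡ P (eq i i) _)))

module RCI = Symmetry rci rci-isPerm (λ perm → rci-involutive perm)
module Inverse = Symmetry inverse inverse-isPerm (λ _ _ → refl)

module _ {n σ σ′} (σ∈ : σ ∈ S n) (h : graph σ′ ↭ map (rci n) (graph σ)) where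
  private perm = graph-isPerm {n} σ∈

  fp-rci-≡ : fp σ ≡ fp σ′
  fp-rci-≡ = trans (fp-graph σ) (trans (sym (fp-rci perm)) (trans (∑-↭ fpK (↭-sym h)) (sym (fp-graph σ′))))

  exc-rci-≡ : exc σ ≡ exc σ′
  exc-rci-≡ = trans (exc-graph σ) (trans (sym (exc-rci perm))
      (trans (∑-↭ excK (↭-sym h)) (sym (exc-graph σ′))))

  inv-rci-≡ : inv σ ≡ inv σ′
  inv-rci-≡ = trans (inv-graph σ) (trans (sym (inv-rci perm))
      (trans (∑∑-↭ invK (↭-sym h)) (sym (inv-graph σ′))))

  crs-rci-≡ : crs σ ≡ crs σ′
  crs-rci-≡ = trans (crs-graph σ) (trans (sym (crs-rci perm))
      (trans (∑∑-↭ crsK (↭-sym h)) (sym (crs-graph σ′))))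

  nes-rci-≡ : nes σ ≡ nes σ′
  nes-rci-≡ = trans (nes-graph σ) (trans (sym (nes-rci perm))
      (trans (∑∑-↭ nesK (↭-sym h)) (sym (nes-graph σ′))))

wilf-rci : ∀ {sts} → (∀ {n σ σ′} → σ ∈ S n → graph σ′ ↭ map (rci n) (graph σ) → stats sts σ ≡ stats sts σ′) →
           WilfEq sts (1 ∷ 3 ∷ 2 ∷ []) (2 ∷ 1 ∷ 3 ∷ [])
wilf-rci {sts} invariant n w = ≤-antisym
  (RCI.count-≤ {1} {3} {2} {2} {1} {3} {sts} (λ _ → rci-213⁻) (λ {n} → invariant {n}) n w)
  (RCI.count-≤ {2} {1} {3} {1} {3} {2} {sts} (λ _ → rci-132⁻) (λ {n} → invariant {n}) n w)

wilf-132-213 : WilfEq (fp ∷ exc ∷ inv ∷ crs ∷ nes ∷ []) (1 ∷ 3 ∷ 2 ∷ []) (2 ∷ 1 ∷ 3 ∷ [])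
wilf-132-213 = wilf-rci λ {n} σ∈ h → cong₂ _∷_ (fp-rci-≡ {n} σ∈ h) (cong₂ _∷_ (exc-rci-≡ {n} σ∈ h)
  (cong₂ _∷_ (inv-rci-≡ {n} σ∈ h) (cong₂ _∷_ (crs-rci-≡ {n} σ∈ h) (cong (_∷ []) (nes-rci-≡ {n} σ∈ h)))))

wilf-132-213-fp-exc-crs : WilfEq (fp ∷ exc ∷ crs ∷ []) (1 ∷ 3 ∷ 2 ∷ []) (2 ∷ 1 ∷ 3 ∷ [])
wilf-132-213-fp-exc-crs = wilf-rci λ {n} σ∈ h →
    cong₂ _∷_ (fp-rci-≡ {n} σ∈ h) (cong₂ _∷_ (exc-rci-≡ {n} σ∈ h) (cong (_∷ []) (crs-rci-≡ {n} σ∈ h)))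

wilf-231-312 : WilfEq (fp ∷ inv ∷ nes ∷ []) (2 ∷ 3 ∷ 1 ∷ []) (3 ∷ 1 ∷ 2 ∷ [])
wilf-231-312 n w = ≤-antisym
  (Inverse.count-≤ {2} {3} {1} {3} {1} {2} (λ {m} _ → inverse-312⁻ {m}) (λ {m} → invariant {m}) n w)
  (Inverse.count-≤ {3} {1} {2} {2} {3} {1} (λ {m} _ → inverse-231⁻ {m}) (λ {m} → invariant {m}) n w)
  where
  invariant : ∀ {n σ σ′} → σ ∈ S n → graph σ′ ↭ map (inverse n) (graph σ) →
      stats (fp ∷ inv ∷ nes ∷ []) σ ≡ stats (fp ∷ inv ∷ nes ∷ []) σ′
  invariant {n} {σ} {σ′} σ∈ h = cong₂ _∷_
      (trans (fp-graph σ) (trans (sym (fp-inverse perm)) (trans (∑-↭ fpK (↭-sym h)) (sym (fp-graph σ′)))))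
    (cong₂ _∷_ (trans (inv-graph σ) (trans (sym (inv-inverse perm))
        (trans (∑∑-↭ invK (↭-sym h)) (sym (inv-graph σ′)))))
    (cong (_∷ []) (trans (nes-graph σ) (trans (sym (nes-inverse perm))
        (trans (∑∑-↭ nesK (↭-sym h)) (sym (nes-graph σ′)))))))
    where perm = graph-isPerm {n} σ∈

-- The six patterns of length three

data S₃ : List ℕ → Set where
  τ₁₂₃ : S₃ (1 ∷ 2 ∷ 3 ∷ [])
  τ₁₃₂ : S₃ (1 ∷ 3 ∷ 2 ∷ [])
  τ₂₁₃ : S₃ (2 ∷ 1 ∷ 3 ∷ [])
  τ₂₃₁ : S₃ (2 ∷ 3 ∷ 1 ∷ [])
  τ₃₁₂ : S₃ (3 ∷ 1 ∷ 2 ∷ [])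
  τ₃₂₁ : S₃ (3 ∷ 2 ∷ 1 ∷ [])

-- `words` varies the first entry fastest, so `S 3` is ordered by the last entry.
S₃-view : ∀ {τ} → τ ∈ S 3 → S₃ τ
S₃-view (here refl) = τ₃₂₁
S₃-view (there (here refl)) = τ₂₃₁
S₃-view (there (there (here refl))) = τ₃₁₂
S₃-view (there (there (there (here refl)))) = τ₁₃₂
S₃-view (there (there (there (there (here refl))))) = τ₂₁₃
S₃-view (there (there (there (there (there (here refl)))))) = τ₁₂₃

theorem4p2 : ((τ′ : List ℕ) → τ′ ∈ S 3 →
    (WilfEq (fp ∷ exc ∷ inv ∷ crs ∷ nes ∷ []) (1 ∷ 3 ∷ 2 ∷ []) τ′
    ⇔ (τ′ ≡ 1 ∷ 3 ∷ 2 ∷ [] ⊎ τ′ ≡ 2 ∷ 1 ∷ 3 ∷ [])))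
    × ((τ′ : List ℕ) → τ′ ∈ S 3 →
    (WilfEq (fp ∷ inv ∷ nes ∷ []) (2 ∷ 3 ∷ 1 ∷ []) τ′
    ⇔ (τ′ ≡ 2 ∷ 3 ∷ 1 ∷ [] ⊎ τ′ ≡ 3 ∷ 1 ∷ 2 ∷ [])))
    × ((τ′ : List ℕ) → τ′ ∈ S 3 →
    (WilfEq (fp ∷ exc ∷ crs ∷ []) (1 ∷ 3 ∷ 2 ∷ []) τ′
    ⇔ (τ′ ≡ 1 ∷ 3 ∷ 2 ∷ [] ⊎ (τ′ ≡ 2 ∷ 1 ∷ 3 ∷ [] ⊎ τ′ ≡ 3 ∷ 2 ∷ 1 ∷ []))))
theorem4p2 = (λ τ τ∈ → mk⇔ (only₁ (S₃-view τ∈)) λ { (inj₁ refl) _ _ → refl ; (inj₂ refl) → wilf-132-213 })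
  , (λ τ τ∈ → mk⇔ (only₂ (S₃-view τ∈)) λ { (inj₁ refl) _ _ → refl ; (inj₂ refl) → wilf-231-312 })
  , (λ τ τ∈ → mk⇔ (only₃ (S₃-view τ∈)) λ { (inj₁ refl) _ _ → refl ; (inj₂ (inj₁ refl)) →
      wilf-132-213-fp-exc-crs ; (inj₂ (inj₂ refl)) → wilf-132-321 })
  where
  only₁ : ∀ {τ} → S₃ τ → WilfEq (fp ∷ exc ∷ inv ∷ crs ∷ nes ∷ []) (1 ∷ 3 ∷ 2 ∷ []) τ →
      τ ≡ 1 ∷ 3 ∷ 2 ∷ [] ⊎ τ ≡ 2 ∷ 1 ∷ 3 ∷ []
  only₁ τ₁₃₂ _ = inj₁ refl
  only₁ τ₂₁₃ _ = inj₂ refl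
  -- This vector belongs to exactly 132 and 213: avoiding 132 leaves one of them, avoiding any of
  -- the four patterns below leaves both.
  only₁ τ₁₂₃ h = contradiction (h 3 (1 ∷ 1 ∷ 1 ∷ 0 ∷ 0 ∷ [])) λ ()
  only₁ τ₂₃₁ h = contradiction (h 3 (1 ∷ 1 ∷ 1 ∷ 0 ∷ 0 ∷ [])) λ ()
  only₁ τ₃₁₂ h = contradiction (h 3 (1 ∷ 1 ∷ 1 ∷ 0 ∷ 0 ∷ [])) λ ()
  only₁ τ₃₂₁ h = contradiction (h 3 (1 ∷ 1 ∷ 1 ∷ 0 ∷ 0 ∷ [])) λ ()

  only₂ : ∀ {τ} → S₃ τ → WilfEq (fp ∷ inv ∷ nes ∷ []) (2 ∷ 3 ∷ 1 ∷ []) τ →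
      τ ≡ 2 ∷ 3 ∷ 1 ∷ [] ⊎ τ ≡ 3 ∷ 1 ∷ 2 ∷ []
  only₂ τ₂₃₁ _ = inj₁ refl
  only₂ τ₃₁₂ _ = inj₂ refl
  -- The vector of exactly 231 and 312, of which avoiding 231 removes one.
  only₂ τ₁₂₃ h = contradiction (h 3 (0 ∷ 2 ∷ 0 ∷ [])) λ ()
  only₂ τ₁₃₂ h = contradiction (h 3 (0 ∷ 2 ∷ 0 ∷ [])) λ ()
  only₂ τ₂₁₃ h = contradiction (h 3 (0 ∷ 2 ∷ 0 ∷ [])) λ ()
  only₂ τ₃₂₁ h = contradiction (h 3 (0 ∷ 2 ∷ 0 ∷ [])) λ ()

  only₃ : ∀ {τ} → S₃ τ → WilfEq (fp ∷ exc ∷ crs ∷ []) (1 ∷ 3 ∷ 2 ∷ []) τ →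
      τ ≡ 1 ∷ 3 ∷ 2 ∷ [] ⊎ (τ ≡ 2 ∷ 1 ∷ 3 ∷ [] ⊎ τ ≡ 3 ∷ 2 ∷ 1 ∷ [])
  only₃ τ₁₃₂ _ = inj₁ refl
  only₃ τ₂₁₃ _ = inj₂ (inj₁ refl)
  only₃ τ₃₂₁ _ = inj₂ (inj₂ refl)
  -- The vector of exactly 132, 213 and 321: avoiding 132 leaves two of them, the remaining patterns
  -- leave all three.
  only₃ τ₁₂₃ h = contradiction (h 3 (1 ∷ 1 ∷ 0 ∷ [])) λ ()
  only₃ τ₂₃₁ h = contradiction (h 3 (1 ∷ 1 ∷ 0 ∷ [])) λ ()
  only₃ τ₃₁₂ h = contradiction (h 3 (1 ∷ 1 ∷ 0 ∷ [])) λ ()
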